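{- For a positive integer $n$, let $A(n)$ denote the number of partitions of $n$ into distinct parts with a gap of at least $2$ between consecutive parts, and let $B(n)$ denote the number of partitions of $n$ into parts $\equiv 1,4 \pmod 5$. Let $C(n)$ denote the number of partitions of $n$ into distinct parts, such that if $o_j$ is the $j$-th odd part (where the odd parts are ordered in ascending order), then the even parts $o_j+2j-3$ and $o_j+2j-1$ do not appear. Let $D(n)$ denote the number of partitions of $n$ into distinct parts, such that if $e_j$ is the $j$-th even part (where the even parts are ordered in ascending order), then the odd parts $e_j+2j-3$ and $e_j+2j-1$ do not appear. Then $A(n)=B(n)=C(n)=D(n)$ for every positive integer $n$.
   Context: The condition in $C(n)$ is imposed for every $j$ from $1$ to the number of odd parts, with $o_1<o_2<\cdots$ all the odd parts of the partition; the condition in $D(n)$ is imposed for every $j$ from $1$ to the number of even parts, with $e_1<e_2<\cdots$ all the even parts. Parts of a partition are positive integers (so the requirement that "the part $0$" does not appear is vacuous). "Gap of at least $2$ between consecutive parts" means consecutive parts (in size order) differ by at least $2$. -}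

module Defs where

open import Data.Empty using (⊥)
open import Data.Fin using (Fin; toℕ)
open import Data.Fin.Properties using (all?)
open import Data.List using (List; []; _∷_; _++_; map; filter; length; lookup)
open import Data.List.Membership.Propositional using (_∈_; _∉_)
open import Data.List.Membership.Propositional.Properties
  using (∈-map⁺; ∈-map⁻; ∈-++⁺ˡ; ∈-++⁺ʳ; ∈-++⁻; ∈-filter⁺; ∈-filter⁻)
import Data.List.Membership.DecPropositional as DecMembership
open import Data.List.Relation.Unary.All as All using (All; []; _∷_)
open import Data.List.Relation.Unary.AllPairs using ([]; _∷_)
open import Data.List.Relation.Unary.Any using (here)
open import Data.List.Relation.Unary.Linked using (Linked; linked?)
open import Data.List.Relation.Unary.Unique.Propositional using (Unique)
import Data.List.Relation.Unary.Unique.Propositional.Properties as Unique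
import Data.List.Relation.Unary.Unique.DecPropositional as DecUnique
open import Data.Nat
open import Data.Nat.Divisibility using (_∣?_)
open import Data.Nat.ListAction using (sum)
open import Data.Nat.Properties using (suc-injective)
open import Data.Product using (_×_; _,_)
open import Data.Sum using (_⊎_; inj₁; inj₂)
open import Function.Bundles using (_⇔_; mk⇔)
open import Relation.Binary.PropositionalEquality using (_≡_; refl; cong)
open import Relation.Nullary.Decidable using (¬?; _×-dec_; _⊎-dec_)
open import Relation.Unary using (Pred; Decidable)
open import Level using (0ℓ)

-- Partitions are listed in ascending order, so that "the j-th odd part" is
-- literally the j-th entry of the sublist of odd parts.
IsPartition : ℕ → List ℕ → Set
IsPartition n xs = All (0 <_) xs × Linked _≤_ xs × sum xs ≡ n

incHead : List ℕ → List ℕ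
incHead []       = []
incHead (x ∷ xs) = suc x ∷ xs

-- The compositions of n + 1.  One of n + 2 either starts with 1, or arises from
-- one of n + 1 by enlarging its first entry.
compositionsSuc : ℕ → List (List ℕ)
compositionsSuc zero    = (1 ∷ []) ∷ []
compositionsSuc (suc n) = map (1 ∷_) (compositionsSuc n) ++ map incHead (compositionsSuc n)

compositions : ℕ → List (List ℕ)
compositions zero    = [] ∷ []
compositions (suc n) = compositionsSuc n

partitions : ℕ → List (List ℕ)
partitions n = filter (linked? _≤?_) (compositions n)

-- `partitions n` lists every partition of n (∈-partitions) exactly once
-- (partitions-unique), so this is the number of partitions satisfying P.
count : {P : Pred (List ℕ) 0ℓ} → Decidable P → ℕ → ℕ
count P? n = length (filter P? (partitions n))

∈-compositionsSuc⁻ : ∀ n {xs} → xs ∈ compositionsSuc n → All (0 <_) xs × sum xs ≡ suc n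
∈-compositionsSuc⁻ zero (here refl) = z<s ∷ [] , refl
∈-compositionsSuc⁻ (suc n) p with ∈-++⁻ (map (1 ∷_) (compositionsSuc n)) p
... | inj₁ q with ∈-map⁻ (1 ∷_) q
...   | _ , r , refl =
        let pos , s = ∈-compositionsSuc⁻ n r in z<s ∷ pos , cong suc s
∈-compositionsSuc⁻ (suc n) p | inj₂ q with ∈-map⁻ incHead q
...   | xs , r , refl with xs | ∈-compositionsSuc⁻ n r
...     | _ ∷ _ | _ ∷ pos , s = z<s ∷ pos , cong suc s

∈-compositionsSuc⁺ : ∀ n {xs} → All (0 <_) xs → sum xs ≡ suc n → xs ∈ compositionsSuc n
∈-compositionsSuc⁺ n {0 ∷ _} (() ∷ _) _
∈-compositionsSuc⁺ zero {1 ∷ []} _ _ = here refl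
∈-compositionsSuc⁺ zero {1 ∷ 0 ∷ _} (_ ∷ () ∷ _) _
∈-compositionsSuc⁺ (suc n) {1 ∷ xs} (_ ∷ pos) s =
  ∈-++⁺ˡ (∈-map⁺ (1 ∷_) (∈-compositionsSuc⁺ n pos (suc-injective s)))
∈-compositionsSuc⁺ (suc n) {suc (suc x) ∷ xs} (_ ∷ pos) s =
  ∈-++⁺ʳ (map (1 ∷_) (compositionsSuc n))
    (∈-map⁺ incHead (∈-compositionsSuc⁺ n {suc x ∷ xs} (z<s ∷ pos) (suc-injective s)))

compositionsSuc-unique : ∀ n → Unique (compositionsSuc n)
compositionsSuc-unique zero    = [] ∷ []
compositionsSuc-unique (suc n) = Unique.++⁺
  (Unique.map⁺ (λ { refl → refl }) (compositionsSuc-unique n))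
  (Unique.map⁺ (incHead-injective _ _) (compositionsSuc-unique n))
  disjoint
  where
  incHead-injective : ∀ xs ys → incHead xs ≡ incHead ys → xs ≡ ys
  incHead-injective []       []       _    = refl
  incHead-injective (_ ∷ _)  (_ ∷ _)  refl = refl

  disjoint : ∀ {xs} → xs ∈ map (1 ∷_) (compositionsSuc n)
                    × xs ∈ map incHead (compositionsSuc n) → ⊥
  disjoint (p , q) with ∈-map⁻ (1 ∷_) p | ∈-map⁻ incHead q
  ... | _ , _ , refl | (0 ∷ _) , r , refl with ∈-compositionsSuc⁻ n r
  ...   | () ∷ _ , _

∈-compositions⁻ : ∀ n {xs} → xs ∈ compositions n → All (0 <_) xs × sum xs ≡ n
∈-compositions⁻ zero    (here refl) = [] , refl
∈-compositions⁻ (suc n) p           = ∈-compositionsSuc⁻ n p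

∈-compositions⁺ : ∀ n {xs} → All (0 <_) xs → sum xs ≡ n → xs ∈ compositions n
∈-compositions⁺ zero    []               _ = here refl
∈-compositions⁺ zero    {0 ∷ _} (() ∷ _) _
∈-compositions⁺ (suc n) pos              s = ∈-compositionsSuc⁺ n pos s

compositions-unique : ∀ n → Unique (compositions n)
compositions-unique zero    = [] ∷ []
compositions-unique (suc n) = compositionsSuc-unique n

∈-partitions : ∀ n {xs} → xs ∈ partitions n ⇔ IsPartition n xs
∈-partitions n = mk⇔
  (λ p → let q , l = ∈-filter⁻ (linked? _≤?_) {xs = compositions n} p
             pos , s = ∈-compositions⁻ n q
         in pos , l , s)
  (λ (pos , l , s) → ∈-filter⁺ (linked? _≤?_) (∈-compositions⁺ n pos s) l)

partitions-unique : ∀ n → Unique (partitions n)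
partitions-unique n = Unique.filter⁺ (linked? _≤?_) (compositions-unique n)

evenParts oddParts : List ℕ → List ℕ
evenParts = filter (2 ∣?_)
oddParts  = filter (λ x → ¬? (2 ∣? x))

-- For i ranging over the positions of ps and j = i + 1, neither pⱼ + 2j - 3
-- nor pⱼ + 2j - 1 occurs in xs.  The truncated subtractions are exact because
-- pⱼ ≥ 1 and j ≥ 1.
Avoids : (ps xs : List ℕ) → Set
Avoids ps xs = (i : Fin (length ps)) →
  let p = lookup ps i
      j = suc (toℕ i)
  in (p + 2 * j ∸ 3) ∉ xs × (p + 2 * j ∸ 1) ∉ xs

GapCondition Mod5Condition OddCondition EvenCondition : List ℕ → Set
GapCondition  xs = Unique xs × Linked (λ x y → x + 2 ≤ y) xs
Mod5Condition xs = All (λ x → x % 5 ≡ 1 ⊎ x % 5 ≡ 4) xs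
OddCondition  xs = Unique xs × Avoids (oddParts xs) xs
EvenCondition xs = Unique xs × Avoids (evenParts xs) xs

avoids? : ∀ ps → Decidable (Avoids ps)
avoids? ps xs = all? λ _ → ¬? (_ ∈? xs) ×-dec ¬? (_ ∈? xs)
  where open DecMembership _≟_ using (_∈?_)

unique? : Decidable (Unique {A = ℕ})
unique? = DecUnique.unique? _≟_

gapCondition? : Decidable GapCondition
gapCondition? xs = unique? xs ×-dec linked? (λ x y → x + 2 ≤? y) xs

mod5Condition? : Decidable Mod5Condition
mod5Condition? = All.all? λ x → (x % 5 ≟ 1) ⊎-dec (x % 5 ≟ 4)

oddCondition? : Decidable OddCondition
oddCondition? xs = unique? xs ×-dec avoids? (oddParts xs) xs

evenCondition? : Decidable EvenCondition
evenCondition? xs = unique? xs ×-dec avoids? (evenParts xs) xs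

A B C D : ℕ → ℕ
A = count gapCondition?
B = count mod5Condition?
C = count oddCondition?
D = count evenCondition?

{-# OPTIONS --safe #-}
module Submission where

-- Let A(m), B(m) be the generating functions of the partitions counted by A and
-- B all of whose parts exceed m.  Removing a least part gives
-- A(m) = A(m+1) + q^(m+1) A(m+2), a recurrence that determines A(m), since
-- A(m) = 1 modulo q^(m+1).  Rogers' alternating series P(m) satisfies the
-- recurrence of (q^(m+1); q)_∞ A(m), so (q; q)_∞ A(0) = P(0), which is a theta
-- series; by the Jacobi triple product it is also (q; q)_∞ B(0).
--
-- For C and D, let p₁ < p₂ < … be the parts of the parity that imposes the
-- condition.  The two numbers forbidden by pᵢ form a domino, and these dominoes
-- are disjoint and avoid the parts of the other parity (monomers).  Let W j a
-- enumerate the tilings beyond position a from which j smaller dominoes have been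
-- removed, and V j a those among them without a monomer in the first place.
-- Removing the first tile gives recurrences which imply V j a = W (j+1) a, and then
-- V 0 m = A(m) = W 0 (m+1), according to the parity of m.

open import Defs
open import Data.Nat using (ℕ; _<_)
open import Data.Product using (_×_)
open import Relation.Binary.PropositionalEquality using (_≡_)

open import Algebra.Bundles using (CommutativeRing)
open import Algebra.Solver.Ring.AlmostCommutativeRing using (_-Raw-AlmostCommutative⟶_; fromCommutativeRing)
import Algebra.Solver.Ring
open import Algebra.Structures using (IsCommutativeRing)
open import Data.Integer as ℤ using (ℤ; +_; -[1+_])
import Data.Integer.Properties as ℤ
open import Data.List using (List; []; _∷_)
open import Data.List.Relation.Unary.All as All using (All; []; _∷_)
open import Data.Maybe as Maybe using ()
open import Data.Nat as ℕ using (zero; suc; _∸_; _≤_; z≤n; s≤s; _%_)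
open import Data.Nat.Divisibility using (_∣_; _∣?_; _∣0; ∣-refl; ∣⇒≤; ∣m∣n⇒∣m+n; ∣m+n∣m⇒∣n)
open import Data.Nat.DivMod using ([m+kn]%n≡m%n)
import Data.Nat.Properties as ℕ
open import Data.Product using (∃; _,_; proj₁; proj₂)
open import Data.Sum using (_⊎_; inj₁; inj₂)
open import Function using (_∘_)
open import Level using (0ℓ)
open import Relation.Binary.PropositionalEquality as ≡ using (_≢_; _≗_)
open import Relation.Nullary using (¬_; yes; no; contradiction)
open import Relation.Nullary.Decidable using (¬?; dec⇒maybe; from-no)
open import Relation.Unary using (Pred; Decidable)

-- Infinite sums and products are avoided by fixing n and computing modulo q^(n+1), which still sees
-- the coefficient of q^n. There q is nilpotent, (b; b)_∞ is a finite product with an explicit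
-- inverse, and "the recurrence determines the solution" becomes downward induction: every family is
-- 1 for large m, and the value at m follows from those at m + 1 and m + 2. In particular the sum of
-- q^(n²+mn) / (q; q)_n is never formed; only its recurrence is used. The difficulty in C and D is
-- that the numbers forbidden by a part depend on how many smaller parts of its parity there are.
-- Removing the least such part therefore leaves a problem of a different kind, with j raised by
-- one, and the recurrences do not close up at j = 0. The identity V j a = W (j+1) a brings the
-- raised index back down, and then both recurrences become the one for A.

descend : ∀ {p} {P : ℕ → Set p} N → (∀ m → N ≤ m → P m) →
          (∀ m → P (suc m) → P (suc (suc m)) → P m) → ∀ m → P m
descend {P = P} N base step m = proj₁ (go N m (ℕ.m≤n+m N m))
  where
  go : ∀ f m → N ≤ m ℕ.+ f → P m × P (suc m)
  go zero m N≤m = base m N≤m' , base (suc m) (ℕ.m≤n⇒m≤1+n N≤m')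
    where N≤m' = ≡.subst (N ≤_) (ℕ.+-identityʳ m) N≤m
  go (suc f) m N≤m with go f (suc m) (≡.subst (N ≤_) (ℕ.+-suc m f) N≤m)
  ... | p , p' = step m p p' , p

-- A ring solver with integer coefficients for an arbitrary commutative ring

module IntegerCoefficients {c ℓ} (R : CommutativeRing c ℓ) where

  open CommutativeRing R
  open import Algebra.Properties.Ring ring using (-0#≈0#; -‿distribˡ-*; -‿distribʳ-*; -‿involutive; -‿+-comm)
  open import Algebra.Properties.Semiring.Mult.TCOptimised semiring using (×-homo-+; ×1-homo-*; 1+×) renaming (_×_ to _·_)
  open import Relation.Binary.Reasoning.Setoid setoid

  -- The canonical homomorphism from ℤ. Cancelling terms requires deciding equality of coefficients,
  -- which is possible in ℤ but not in an abstract ring.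
  ⟦_⟧ : ℤ → Carrier
  ⟦ + n ⟧      = n · 1#
  ⟦ -[1+ n ] ⟧ = - (suc n · 1#)

  neg-homo : ∀ i → ⟦ ℤ.- i ⟧ ≈ - ⟦ i ⟧
  neg-homo (+ zero)  = sym -0#≈0#
  neg-homo (+ suc n) = refl
  neg-homo -[1+ n ]  = sym (-‿involutive _)

  ⊖-homo : ∀ m n → ⟦ m ℤ.⊖ n ⟧ ≈ m · 1# - n · 1#
  ⊖-homo m       zero    = sym (trans (+-congˡ -0#≈0#) (+-identityʳ _))
  ⊖-homo zero    (suc n) = sym (+-identityˡ _)
  ⊖-homo (suc m) (suc n) = begin
    ⟦ suc m ℤ.⊖ suc n ⟧               ≡⟨ ≡.cong ⟦_⟧ (ℤ.[1+m]⊖[1+n]≡m⊖n m n) ⟩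
    ⟦ m ℤ.⊖ n ⟧                       ≈⟨ ⊖-homo m n ⟩
    m · 1# - n · 1#                   ≈⟨ +-congʳ (+-identityʳ _) ⟨
    m · 1# + 0# - n · 1#              ≈⟨ +-congʳ (+-congˡ (-‿inverseʳ 1#)) ⟨
    m · 1# + (1# - 1#) - n · 1#       ≈⟨ +-congʳ (+-assoc _ _ _) ⟨
    m · 1# + 1# - 1# - n · 1#         ≈⟨ +-assoc _ _ _ ⟩
    m · 1# + 1# + (- 1# - n · 1#)     ≈⟨ +-cong (+-comm _ _) (-‿+-comm 1# (n · 1#)) ⟩
    1# + m · 1# - (1# + n · 1#)       ≈⟨ +-cong (1+× m 1#) (-‿cong (1+× n 1#)) ⟨
    suc m · 1# - suc n · 1#           ∎

  +-homo : ∀ i j → ⟦ i ℤ.+ j ⟧ ≈ ⟦ i ⟧ + ⟦ j ⟧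
  +-homo (+ m)    (+ n)    = ×-homo-+ 1# m n
  +-homo (+ m)    -[1+ n ] = ⊖-homo m (suc n)
  +-homo -[1+ m ] (+ n)    = trans (⊖-homo n (suc m)) (+-comm _ _)
  +-homo -[1+ m ] -[1+ n ] = begin
    - (suc (suc (m ℕ.+ n)) · 1#)        ≡⟨ ≡.cong (λ k → - (k · 1#)) (ℕ.+-suc (suc m) n) ⟨
    - ((suc m ℕ.+ suc n) · 1#)          ≈⟨ -‿cong (×-homo-+ 1# (suc m) (suc n)) ⟩
    - (suc m · 1# + suc n · 1#)         ≈⟨ -‿+-comm _ _ ⟨
    - (suc m · 1#) - suc n · 1#         ∎

  pos-*-homo : ∀ m j → ⟦ + m ℤ.* j ⟧ ≈ m · 1# * ⟦ j ⟧
  pos-*-homo m (+ n)    = begin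
    ⟦ + m ℤ.* + n ⟧    ≡⟨ ≡.cong ⟦_⟧ (ℤ.pos-* m n) ⟨
    (m ℕ.* n) · 1#     ≈⟨ ×1-homo-* m n ⟩
    m · 1# * n · 1#    ∎
  pos-*-homo m -[1+ n ] = begin
    ⟦ + m ℤ.* ℤ.- (+ suc n) ⟧      ≡⟨ ≡.cong ⟦_⟧ (ℤ.neg-distribʳ-* (+ m) (+ suc n)) ⟨
    ⟦ ℤ.- (+ m ℤ.* + suc n) ⟧      ≈⟨ neg-homo (+ m ℤ.* + suc n) ⟩
    - ⟦ + m ℤ.* + suc n ⟧          ≈⟨ -‿cong (pos-*-homo m (+ suc n)) ⟩
    - (m · 1# * suc n · 1#)        ≈⟨ -‿distribʳ-* _ _ ⟩
    m · 1# * - (suc n · 1#)        ∎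

  *-homo : ∀ i j → ⟦ i ℤ.* j ⟧ ≈ ⟦ i ⟧ * ⟦ j ⟧
  *-homo (+ m)    j = pos-*-homo m j
  *-homo -[1+ m ] j = begin
    ⟦ ℤ.- (+ suc m) ℤ.* j ⟧    ≡⟨ ≡.cong ⟦_⟧ (ℤ.neg-distribˡ-* (+ suc m) j) ⟨
    ⟦ ℤ.- (+ suc m ℤ.* j) ⟧    ≈⟨ neg-homo (+ suc m ℤ.* j) ⟩
    - ⟦ + suc m ℤ.* j ⟧        ≈⟨ -‿cong (pos-*-homo (suc m) j) ⟩
    - (suc m · 1# * ⟦ j ⟧)     ≈⟨ -‿distribˡ-* _ _ ⟩
    - (suc m · 1#) * ⟦ j ⟧     ∎

  ℤ⟶R : CommutativeRing.rawRing ℤ.+-*-commutativeRing -Raw-AlmostCommutative⟶ fromCommutativeRing R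
  -- With the optimised multiples, `0 · 1#` and `1 · 1#` compute to `0#` and `1#`, so these two laws
  -- hold by `refl`, and `𝟘` and `𝟙` evaluate to the constants on the nose.
  ℤ⟶R = record
    { ⟦_⟧ = ⟦_⟧ ; +-homo = +-homo ; *-homo = *-homo ; -‿homo = neg-homo ; 0-homo = refl ; 1-homo = refl }

  open Algebra.Solver.Ring _ (fromCommutativeRing R) ℤ⟶R
    (λ i j → Maybe.map (λ eq → reflexive (≡.cong ⟦_⟧ eq)) (dec⇒maybe (i ℤ.≟ j)))
    public using (Polynomial; solve; con; _:=_; _:+_; _:*_; _:-_; :-_; _:^_)

  𝟙 : ∀ {n} → Polynomial n
  𝟙 = con (+ 1)

  𝟘 : ∀ {n} → Polynomial n
  𝟘 = con (+ 0)

-- Finite sums, shifted factorials and theta terms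

module QSeries {c ℓ} (R : CommutativeRing c ℓ) where
  open CommutativeRing R
  open import Algebra.Properties.Semiring.Exp semiring
  open import Algebra.Properties.CommutativeSemiring.Exp commutativeSemiring using (^-distrib-*)
  open import Relation.Binary.Reasoning.Setoid setoid
  open import Algebra.Properties.Ring ring using (-0#≈0#)
  open IntegerCoefficients R

  -- Leaves the solver with a polynomial identity: k is the cofactor of the
  -- relation a - b in x - y.
  eliminate : ∀ k {a b x y} → a ≈ b → x ≈ y + k * (a - b) → x ≈ y
  eliminate k {a} {b} {x} {y} a≈b eq = begin
    x               ≈⟨ eq ⟩
    y + k * (a - b) ≈⟨ +-congˡ (*-congˡ (trans (+-congʳ a≈b) (-‿inverseʳ b))) ⟩
    y + k * 0#      ≈⟨ trans (+-congˡ (zeroʳ k)) (+-identityʳ y) ⟩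
    y               ∎

  1-0 : ∀ {x} → x ≈ 0# → 1# - x ≈ 1#
  1-0 x≈0 = trans (+-congˡ (trans (-‿cong x≈0) -0#≈0#)) (+-identityʳ 1#)

  *-zeroˡ : ∀ {x} y → x ≈ 0# → x * y ≈ 0#
  *-zeroˡ y x≈0 = trans (*-congʳ x≈0) (zeroˡ y)

  *-zeroʳ : ∀ x {y} → y ≈ 0# → x * y ≈ 0#
  *-zeroʳ x y≈0 = trans (*-congˡ y≈0) (zeroʳ x)

  ∑ : ℕ → (ℕ → Carrier) → Carrier
  ∑ zero    f = 0#
  ∑ (suc n) f = ∑ n f + f n

  ∑-cong : ∀ n {f g : ℕ → Carrier} → (∀ i → i < n → f i ≈ g i) → ∑ n f ≈ ∑ n g
  ∑-cong zero    f≈g = refl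
  ∑-cong (suc n) f≈g = +-cong (∑-cong n (λ i i<n → f≈g i (ℕ.m<n⇒m<1+n i<n))) (f≈g n ℕ.≤-refl)

  ∑-+ : ∀ n f g → ∑ n (λ i → f i + g i) ≈ ∑ n f + ∑ n g
  ∑-+ zero    f g = sym (+-identityʳ 0#)
  ∑-+ (suc n) f g = trans (+-congʳ (∑-+ n f g))
    (solve 4 (λ a b c d → (a :+ b) :+ (c :+ d) := (a :+ c) :+ (b :+ d)) refl (∑ n f) (∑ n g) (f n) (g n))

  ∑-* : ∀ n a f → ∑ n (λ i → a * f i) ≈ a * ∑ n f
  ∑-* zero    a f = sym (zeroʳ a)
  ∑-* (suc n) a f = trans (+-congʳ (∑-* n a f)) (sym (distribˡ a (∑ n f) (f n)))

  -- The shape of the recurrences between sums below: `h` is a certificate checked summand by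
  -- summand, and only its two boundary values survive.
  ∑-telescope : ∀ n {f g : ℕ → Carrier} (h : ℕ → Carrier) → (∀ i → i < n → f i ≈ g i + (h i - h (suc i))) →
                ∑ n f ≈ ∑ n g + (h 0 - h n)
  ∑-telescope zero    h step = sym (trans (+-identityˡ _) (-‿inverseʳ (h 0)))
  ∑-telescope (suc n) {f} {g} h step = begin
    ∑ n f + f n
      ≈⟨ +-cong (∑-telescope n h (λ i i<n → step i (ℕ.m<n⇒m<1+n i<n))) (step n ℕ.≤-refl) ⟩
    (∑ n g + (h 0 - h n)) + (g n + (h n - h (suc n)))
      ≈⟨ solve 5 (λ a b c d e → (a :+ (b :- c)) :+ (d :+ (c :- e)) := (a :+ d) :+ (b :- e)) refl (∑ n g) (h 0) (h n) (g n) (h (suc n)) ⟩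
    (∑ n g + g n) + (h 0 - h (suc n)) ∎

  ∑-truncate : ∀ k n {f : ℕ → Carrier} → (∀ i → n ≤ i → f i ≈ 0#) → ∑ (k ℕ.+ n) f ≈ ∑ n f
  ∑-truncate zero    n f≈0 = refl
  ∑-truncate (suc k) n f≈0 =
    trans (+-cong (∑-truncate k n f≈0) (f≈0 (k ℕ.+ n) (ℕ.m≤n+m n k))) (+-identityʳ _)

  ∑-head : ∀ n {f : ℕ → Carrier} → (∀ i → f (suc i) ≈ 0#) → ∑ (suc n) f ≈ f 0
  ∑-head zero    f≈0 = +-identityˡ _
  ∑-head (suc n) f≈0 = trans (+-cong (∑-head n f≈0) (f≈0 n)) (+-identityʳ _)

  -- (a; b)ₙ
  poch : Carrier → Carrier → ℕ → Carrier
  poch a b zero    = 1#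
  poch a b (suc n) = poch a b n * (1# - a * b ^ n)

  poch-cong : ∀ {a a'} b n → a ≈ a' → poch a b n ≈ poch a' b n
  poch-cong b zero    a≈a' = refl
  poch-cong b (suc n) a≈a' = *-cong (poch-cong b n a≈a') (+-congˡ (-‿cong (*-congʳ a≈a')))

  poch-zero : ∀ {a} b n → a ≈ 0# → poch a b n ≈ 1#
  poch-zero b zero    a≈0 = refl
  poch-zero b (suc n) a≈0 =
    trans (*-cong (poch-zero b n a≈0) (1-0 (*-zeroˡ (b ^ n) a≈0))) (*-identityʳ 1#)

  -- Both sides are the product of 1 - a bⁱ over 0 ≤ i ≤ n, with the first or the last factor split
  -- off.
  poch-shift : ∀ a b n → (1# - a) * poch (b * a) b n ≈ poch a b n * (1# - a * b ^ n)
  poch-shift a b zero    = solve 1 (λ a → (𝟙 :- a) :* 𝟙 := 𝟙 :* (𝟙 :- a :* 𝟙)) refl a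
  poch-shift a b (suc n) =
    eliminate (1# - b * a * b ^ n) (poch-shift a b n)
    (solve 5 (λ a b w p p' → (𝟙 :- a) :* (p' :* (𝟙 :- b :* a :* w)) :=
       p :* (𝟙 :- a :* w) :* (𝟙 :- a :* (b :* w))
       :+ (𝟙 :- b :* a :* w) :* ((𝟙 :- a) :* p' :- p :* (𝟙 :- a :* w)))
     refl a b (b ^ n) (poch a b n) (poch (b * a) b n))

  poch-step : ∀ a b n → a * b ^ n ≈ 0# → poch a b n ≈ (1# - a) * poch (b * a) b n
  poch-step a b n ab^n≈0 = sym (trans (poch-shift a b n)
    (trans (*-congˡ (1-0 ab^n≈0)) (*-identityʳ _)))

  -- (-1)ⁱ xⁱ b^(i(i-1)/2)
  theta : Carrier → Carrier → ℕ → Carrier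
  theta x b zero    = 1#
  theta x b (suc i) = - (theta x b i * (x * b ^ i))

  theta-shift : ∀ x b i → theta (b * x) b i ≈ b ^ i * theta x b i
  theta-shift x b zero    = sym (*-identityʳ 1#)
  theta-shift x b (suc i) = eliminate (- (b * x * b ^ i)) (theta-shift x b i)
    (solve 5 (λ x b w t t' → :- (t' :* (b :* x :* w)) :=
       b :* w :* (:- (t :* (x :* w))) :+ (:- (b :* x :* w)) :* (t' :- w :* t)) refl x b (b ^ i) (theta x b i) (theta (b * x) b i))

  theta-zero : ∀ {x} b i → x ≈ 0# → theta x b (suc i) ≈ 0#
  theta-zero b i x≈0 = trans (-‿cong (*-zeroʳ _ (*-zeroˡ (b ^ i) x≈0))) -0#≈0#

  -- Nilpotent q: reciprocals and Euler's series

  -- Since q is nilpotent, infinite sums and products of powers of q are finite;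
  -- in particular (a; b)_∞ is poch a b N whenever q divides b.
  module Nilpotent (q : Carrier) (M : ℕ) (q^N≈0 : q ^ suc M ≈ 0#) where

    N : ℕ
    N = suc M

    q^-vanish : ∀ {k} → N ≤ k → q ^ k ≈ 0#
    q^-vanish {k} N≤k = begin
      q ^ k                  ≡⟨ ≡.cong (q ^_) (ℕ.m+[n∸m]≡n N≤k) ⟨
      q ^ (N ℕ.+ (k ∸ N))    ≈⟨ ^-homo-* q N (k ∸ N) ⟩
      q ^ N * q ^ (k ∸ N)    ≈⟨ *-zeroˡ _ q^N≈0 ⟩
      0#                     ∎

    Divisible : Carrier → Set _
    Divisible x = ∃ λ y → x ≈ q * y

    divisible-* : ∀ a {x} → Divisible x → Divisible (a * x)
    divisible-* a (y , x≈qy) = a * y , trans (*-congˡ x≈qy)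
      (solve 3 (λ a q y → a :* (q :* y) := q :* (a :* y)) refl a q y)

    divisible-^ : ∀ {x} n → N ≤ n → Divisible x → x ^ n ≈ 0#
    divisible-^ {x} n N≤n (y , x≈qy) =
      trans (^-congˡ n x≈qy) (trans (^-distrib-* q y n) (*-zeroˡ _ (q^-vanish N≤n)))

    theta-vanish : ∀ {x} b {i} → N ≤ i → Divisible x → theta x b i ≈ 0#
    theta-vanish {x} b {i} N≤i (y , x≈qy) with factor i
      where
      factor : ∀ i → ∃ λ u → theta x b i ≈ q ^ i * u
      factor zero = 1# , sym (*-identityʳ 1#)
      factor (suc i) with factor i
      ... | u , eq = - (u * (y * b ^ i)) , trans (-‿cong (*-cong eq (*-congʳ x≈qy)))
        (solve 5 (λ q w u y v → :- (w :* u :* (q :* y :* v)) := q :* w :* (:- (u :* (y :* v)))) refl q (q ^ i) u y (b ^ i))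
    ... | u , eq = trans eq (*-zeroˡ u (q^-vanish N≤i))

    inv : Carrier → Carrier
    inv x = ∑ N (x ^_)

    inv-inverse : ∀ {x} → x ^ N ≈ 0# → (1# - x) * inv x ≈ 1#
    inv-inverse {x} x^N≈0 = begin
      (1# - x) * ∑ N (x ^_)             ≈⟨ ∑-* N (1# - x) (x ^_) ⟨
      ∑ N (λ i → (1# - x) * x ^ i)      ≈⟨ ∑-telescope N {g = λ _ → 0#} (x ^_) (λ i _ →
                                             solve 2 (λ x w → (𝟙 :- x) :* w := 𝟘 :+ (w :- x :* w)) refl x (x ^ i)) ⟩
      ∑ N (λ _ → 0#) + (1# - x ^ N)     ≈⟨ +-cong (∑-head M (λ _ → refl)) (1-0 x^N≈0) ⟩
      0# + 1#                           ≈⟨ +-identityˡ 1# ⟩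
      1#                                ∎

    -- 1 / (b; b)ₙ
    recip : Carrier → ℕ → Carrier
    recip b zero    = 1#
    recip b (suc n) = recip b n * inv (b ^ suc n)

    recip-suc : ∀ {b} → Divisible b → ∀ n → (1# - b ^ suc n) * recip b (suc n) ≈ recip b n
    recip-suc {b} (y , b≈qy) n = begin
      (1# - b ^ suc n) * (recip b n * inv (b ^ suc n))
        ≈⟨ solve 3 (λ u r i → u :* (r :* i) := r :* (u :* i)) refl (1# - b ^ suc n) (recip b n) (inv (b ^ suc n)) ⟩
      recip b n * ((1# - b ^ suc n) * inv (b ^ suc n))
        ≈⟨ *-congˡ (inv-inverse (divisible-^ N ℕ.≤-refl
             (y * b ^ n , trans (*-congʳ b≈qy) (*-assoc q y (b ^ n))))) ⟩
      recip b n * 1#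
        ≈⟨ *-identityʳ _ ⟩
      recip b n ∎

    poch-recip : ∀ {b} → Divisible b → ∀ n → poch b b n * recip b n ≈ 1#
    poch-recip q∣b zero = *-identityʳ 1#
    poch-recip {b} q∣b (suc n) = begin
      poch b b n * (1# - b ^ suc n) * recip b (suc n)     ≈⟨ *-assoc _ _ _ ⟩
      poch b b n * ((1# - b ^ suc n) * recip b (suc n))   ≈⟨ *-congˡ (recip-suc q∣b n) ⟩
      poch b b n * recip b n                              ≈⟨ poch-recip q∣b n ⟩
      1#                                                  ∎

    recip-stable : ∀ {b n} → Divisible b → N ≤ n → recip b n ≈ recip b N
    recip-stable {b} {n} q∣b N≤n = trans (reflexive (≡.cong (recip b) (≡.sym (ℕ.m∸n+n≡m N≤n)))) (go (n ∸ N))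
      where
      go : ∀ k → recip b (k ℕ.+ N) ≈ recip b N
      go zero    = refl
      go (suc k) = begin
        recip b (suc (k ℕ.+ N))                                ≈⟨ *-identityˡ _ ⟨
        1# * recip b (suc (k ℕ.+ N))                           ≈⟨ *-congʳ (1-0 (divisible-^ (suc k ℕ.+ N) (ℕ.m≤n+m N (suc k)) q∣b)) ⟨
        (1# - b ^ suc (k ℕ.+ N)) * recip b (suc (k ℕ.+ N))     ≈⟨ recip-suc q∣b (k ℕ.+ N) ⟩
        recip b (k ℕ.+ N)                                      ≈⟨ go k ⟩
        recip b N                                              ∎

    -- The series F satisfies F(a) = (1 - a) F(ba), as the product does. After n applications the
    -- argument is bⁿa = 0, where only the constant term remains.
    euler : ∀ {a b} n → Divisible b → Divisible a → b ^ n * a ≈ 0# →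
            ∑ N (λ i → theta a b i * recip b i) ≈ poch a b n
    euler {a} {b} zero q∣b q∣a 1*a≈0 = trans
      (∑-head M (λ i → *-zeroˡ _ (theta-zero b i (trans (sym (*-identityˡ a)) 1*a≈0)))) (*-identityʳ 1#)
    euler {a} {b} (suc n) q∣b q∣a b^na≈0 = begin
      ∑ N (λ i → theta a b i * recip b i)
        ≈⟨ ∑-telescope N {g = λ i → (1# - a) * (theta (b * a) b i * recip b i)} h (λ i _ → step i) ⟩
      ∑ N (λ i → (1# - a) * (theta (b * a) b i * recip b i)) + (h 0 - h N)
        ≈⟨ +-cong (∑-* N (1# - a) _) (+-cong
             (solve 0 (𝟙 :* ((𝟙 :- 𝟙) :* 𝟙) := 𝟘) refl)
             (-‿cong (*-zeroˡ _ (theta-vanish b ℕ.≤-refl q∣a)))) ⟩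
      (1# - a) * ∑ N (λ i → theta (b * a) b i * recip b i) + (0# - 0#)
        ≈⟨ trans (+-congˡ (-‿inverseʳ 0#)) (+-identityʳ _) ⟩
      (1# - a) * ∑ N (λ i → theta (b * a) b i * recip b i)
        ≈⟨ *-congˡ (euler n q∣b (divisible-* b q∣a) (trans
             (solve 3 (λ b w a → w :* (b :* a) := b :* w :* a) refl b (b ^ n) a) b^na≈0)) ⟩
      (1# - a) * poch (b * a) b n
        ≈⟨ poch-shift a b n ⟩
      poch a b (suc n) ∎
      where
      h : ℕ → Carrier
      -- The factor 1 - bⁱ makes `h 0` vanish and, by `recip-suc`, cancels the new denominator in
      -- `h (suc i)`.
      h i = theta a b i * ((1# - b ^ i) * recip b i)
      step : ∀ i → theta a b i * recip b i ≈ (1# - a) * (theta (b * a) b i * recip b i) + (h i - h (suc i))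
      step i = eliminate (- ((1# - a) * recip b i)) (theta-shift a b i)
        (eliminate (- (theta a b i * (a * b ^ i))) (recip-suc q∣b i)
        (solve 7 (λ a b w t t' r r' → t :* r :=
          (𝟙 :- a) :* (t' :* r) :+ (t :* ((𝟙 :- w) :* r) :- (:- (t :* (a :* w))) :* ((𝟙 :- b :* w) :* r'))
          :+ (:- ((𝟙 :- a) :* r)) :* (t' :- w :* t)
          :+ (:- (t :* (a :* w))) :* ((𝟙 :- b :* w) :* r' :- r))
          refl a b (b ^ i) (theta a b i) (theta (b * a) b i) (recip b i) (recip b (suc i))))

    -- The Jacobi triple product

    Q : Carrier
    Q = q ^ 5

    X Y : ℕ → Carrier
    X = theta (q ^ 2) Q
    Y = theta (q ^ 3) Q

    -- S b is the sum over all integers j ≤ b of (-1)ʲ q^(j(5j-1)/2) / (Q; Q)_(b-j),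
    -- where tail collects the terms with j ≤ 0.  It is Euler's series for (q³; Q)_∞
    -- when b = 0 and tends to the theta series divided by (Q; Q)_∞.
    conv tail S : ℕ → Carrier
    conv b = ∑ (suc b) (λ j → X j * recip Q (b ∸ j))
    tail b = ∑ N (λ i → Y i * recip Q (b ℕ.+ i))
    S b = conv b - recip Q b + tail b

    q∣q^ : ∀ k → Divisible (q ^ suc k)
    q∣q^ k = q ^ k , refl

    conv-suc : ∀ b → conv (suc b) ≈ (1# - q ^ 2 * Q ^ b) * conv b + (recip Q (suc b) - recip Q b)
    conv-suc b = begin
      ∑ (suc b) (λ j → X j * recip Q (suc b ∸ j)) + X (suc b) * recip Q (b ∸ b)
        ≈⟨ +-congʳ (∑-telescope (suc b) h (λ { j (s≤s j≤b) → step j j≤b })) ⟩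
      ∑ (suc b) (λ j → a * (X j * recip Q (b ∸ j))) + (h 0 - h (suc b)) + X (suc b) * recip Q (b ∸ b)
        ≈⟨ +-cong (+-cong (∑-* (suc b) a _) (+-congˡ (-‿cong (*-congˡ {X (suc b)}
             (*-congʳ {recip Q (b ∸ b)} (^-congʳ Q (ℕ.n∸n≡0 b))))))) refl ⟩
      a * conv b + (1# * (Q ^ suc b * recip Q (suc b)) - X (suc b) * (1# * recip Q (b ∸ b))) + X (suc b) * recip Q (b ∸ b)
        ≈⟨ eliminate (- 1#) (recip-suc (q∣q^ 4) b)
             (solve 6 (λ c B r r' x s → c :+ (𝟙 :* (B :* r') :- x :* (𝟙 :* s)) :+ x :* s :=
                c :+ (r' :- r) :+ (:- 𝟙) :* ((𝟙 :- B) :* r' :- r))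
              refl (a * conv b) (Q ^ suc b) (recip Q b) (recip Q (suc b)) (X (suc b)) (recip Q (b ∸ b))) ⟩
      a * conv b + (recip Q (suc b) - recip Q b) ∎
      where
      a : Carrier
      a = 1# - q ^ 2 * Q ^ b
      h : ℕ → Carrier
      -- `X (suc j)` contributes -q²Qʲ and the power of Q in `h (suc j)` contributes Q^(b-j); their
      -- product -q²Qᵇ no longer depends on j, which produces the factor `a`.
      h j = X j * (Q ^ (suc b ∸ j) * recip Q (suc b ∸ j))
      step : ∀ j → j ≤ b → X j * recip Q (suc b ∸ j) ≈ a * (X j * recip Q (b ∸ j)) + (h j - h (suc j))
      step j j≤b rewrite ℕ.+-∸-assoc 1 j≤b =
        eliminate (X j) (recip-suc (q∣q^ 4) (b ∸ j))
        (eliminate (- (X j * q ^ 2 * recip Q (b ∸ j)))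
          (trans (sym (^-homo-* Q j (b ∸ j))) (^-congʳ Q (ℕ.m+[n∸m]≡n j≤b)))
        (solve 8 (λ q Q B u v x r r' → x :* r' :=
           (𝟙 :- q :^ 2 :* B) :* (x :* r) :+ (x :* (Q :* v :* r') :- (:- (x :* (q :^ 2 :* u))) :* (v :* r))
           :+ x :* ((𝟙 :- Q :* v) :* r' :- r)
           :+ (:- (x :* q :^ 2 :* r)) :* (u :* v :- B))
         refl q Q (Q ^ b) (Q ^ j) (Q ^ (b ∸ j)) (X j) (recip Q (b ∸ j)) (recip Q (suc (b ∸ j)))))

    tail-suc : ∀ b → tail (suc b) ≈ (1# - q ^ 2 * Q ^ b) * tail b + q ^ 2 * Q ^ b * recip Q b
    tail-suc b = begin
      tail (suc b)
        ≈⟨ ∑-telescope N h (λ i _ → step i) ⟩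
      ∑ N (λ i → a * (Y i * recip Q (b ℕ.+ i))) + (h 0 - h N)
        ≈⟨ +-cong (∑-* N a _) (+-cong
             (*-congˡ {q ^ 2 * Q ^ b} (trans (*-identityˡ _) (reflexive (≡.cong (recip Q) (ℕ.+-identityʳ b)))))
             (trans (-‿cong (*-zeroʳ (q ^ 2 * Q ^ b) (*-zeroˡ (recip Q (b ℕ.+ N)) (theta-vanish Q ℕ.≤-refl (q∣q^ 2))))) -0#≈0#)) ⟩
      a * tail b + (q ^ 2 * Q ^ b * recip Q b + 0#)
        ≈⟨ +-congˡ (+-identityʳ _) ⟩
      a * tail b + q ^ 2 * Q ^ b * recip Q b ∎
      where
      a : Carrier
      a = 1# - q ^ 2 * Q ^ b
      h : ℕ → Carrier
      -- Since q² · q³ = Q, the factor -q³Qⁱ in `Y (suc i)` turns `h (suc i)` into -Q^(b+i+1) times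
      -- the new summand, which is what `recip-suc` requires.
      h i = q ^ 2 * Q ^ b * (Y i * recip Q (b ℕ.+ i))
      step : ∀ i → Y i * recip Q (suc b ℕ.+ i) ≈ a * (Y i * recip Q (b ℕ.+ i)) + (h i - h (suc i))
      step i rewrite ℕ.+-suc b i =
        eliminate (Y i) (recip-suc (q∣q^ 4) (b ℕ.+ i))
        (eliminate (Y i * Q * recip Q (suc (b ℕ.+ i))) (^-homo-* Q b i)
        (solve 7 (λ q B u s y r r' → y :* r' :=
           (𝟙 :- q :^ 2 :* B) :* (y :* r)
           :+ (q :^ 2 :* B :* (y :* r) :- q :^ 2 :* B :* ((:- (y :* (q :^ 3 :* u))) :* r'))
           :+ y :* ((𝟙 :- q :^ 5 :* s) :* r' :- r)
           :+ y :* q :^ 5 :* r' :* (s :- B :* u))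
         refl q (Q ^ b) (Q ^ i) (Q ^ (b ℕ.+ i)) (Y i) (recip Q (b ℕ.+ i)) (recip Q (suc (b ℕ.+ i)))))

    -- A half-finite form of the triple product. The corrections in `conv-suc` and `tail-suc`,
    -- together with the subtracted `recip Q (suc b)`, add up to -(1 - q²Qᵇ) `recip Q b`, so passing
    -- from b to b + 1 multiplies `S b` by exactly one more factor.
    S≈poch : ∀ b → S b ≈ poch (q ^ 2) Q b * poch (q ^ 3) Q N
    S≈poch zero = begin
      (0# + 1# * 1#) - 1# + tail 0
        ≈⟨ solve 1 (λ t → (𝟘 :+ 𝟙 :* 𝟙) :- 𝟙 :+ t := 𝟙 :* t) refl (tail 0) ⟩
      1# * tail 0
        ≈⟨ *-congˡ (euler N (q∣q^ 4) (q∣q^ 2) (*-zeroˡ _ (divisible-^ N ℕ.≤-refl (q∣q^ 4)))) ⟩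
      1# * poch (q ^ 3) Q N ∎
    S≈poch (suc b) = begin
      conv (suc b) - recip Q (suc b) + tail (suc b)
        ≈⟨ +-cong (+-congʳ (conv-suc b)) (tail-suc b) ⟩
      (1# - q ^ 2 * Q ^ b) * conv b + (recip Q (suc b) - recip Q b) - recip Q (suc b)
        + ((1# - q ^ 2 * Q ^ b) * tail b + q ^ 2 * Q ^ b * recip Q b)
        ≈⟨ solve 5 (λ B c t r r' → (𝟙 :- B) :* c :+ (r' :- r) :- r' :+ ((𝟙 :- B) :* t :+ B :* r) :=
                (𝟙 :- B) :* (c :- r :+ t)) refl (q ^ 2 * Q ^ b) (conv b) (tail b) (recip Q b) (recip Q (suc b)) ⟩
      (1# - q ^ 2 * Q ^ b) * S b
        ≈⟨ *-congˡ (S≈poch b) ⟩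
      (1# - q ^ 2 * Q ^ b) * (poch (q ^ 2) Q b * poch (q ^ 3) Q N)
        ≈⟨ solve 3 (λ u p p' → u :* (p :* p') := p :* u :* p') refl _ (poch (q ^ 2) Q b) (poch (q ^ 3) Q N) ⟩
      poch (q ^ 2) Q (suc b) * poch (q ^ 3) Q N ∎

    -- At b = 2N the terms of `conv` with j ≥ N vanish, and those with j < N have b - j ≥ N, where
    -- the reciprocals are already stable.
    S-limit : S (N ℕ.+ N) ≈ (∑ N X + ∑ N Y - 1#) * recip Q N
    S-limit = begin
      conv (N ℕ.+ N) - recip Q (N ℕ.+ N) + tail (N ℕ.+ N)
        ≈⟨ +-cong (+-cong conv-limit (-‿cong (recip-stable (q∣q^ 4) (ℕ.m≤m+n N N)))) tail-limit ⟩
      recip Q N * ∑ N X - recip Q N + recip Q N * ∑ N Y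
        ≈⟨ solve 3 (λ r x y → r :* x :- r :+ r :* y := (x :+ y :- 𝟙) :* r) refl (recip Q N) (∑ N X) (∑ N Y) ⟩
      (∑ N X + ∑ N Y - 1#) * recip Q N ∎
      where
      conv-limit : conv (N ℕ.+ N) ≈ recip Q N * ∑ N X
      conv-limit = begin
        conv (N ℕ.+ N)
          ≈⟨ ∑-truncate (suc N) N (λ j N≤j → *-zeroˡ (recip Q (N ℕ.+ N ∸ j)) (theta-vanish Q N≤j (q∣q^ 1))) ⟩
        ∑ N (λ j → X j * recip Q (N ℕ.+ N ∸ j))
          ≈⟨ ∑-cong N (λ j j<N → trans (*-congˡ (recip-stable (q∣q^ 4)
               (≡.subst (N ≤_) (≡.sym (ℕ.+-∸-assoc N (ℕ.<⇒≤ j<N))) (ℕ.m≤m+n N (N ∸ j))))) (*-comm (X j) (recip Q N))) ⟩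
        ∑ N (λ j → recip Q N * X j)
          ≈⟨ ∑-* N (recip Q N) X ⟩
        recip Q N * ∑ N X ∎
      tail-limit : tail (N ℕ.+ N) ≈ recip Q N * ∑ N Y
      tail-limit = trans
        (∑-cong N (λ i _ → trans (*-congˡ (recip-stable (q∣q^ 4)
          (ℕ.≤-trans (ℕ.m≤m+n N N) (ℕ.m≤m+n (N ℕ.+ N) i)))) (*-comm (Y i) (recip Q N))))
        (∑-* N (recip Q N) Y)

    -- The exponents j(5j-1)/2 at j = i + 1 and at j = -i differ by 4i + 2. Pairing these two terms
    -- gives the summands of `Θ`, the form in which the theta series arises from `P 0`.
    X-suc : ∀ i → X (suc i) ≈ - (Y i * (q ^ 2 * (q ^ i) ^ 4))
    X-suc zero = solve 1 (λ q → :- (𝟙 :* (q :^ 2 :* 𝟙)) := :- (𝟙 :* (q :^ 2 :* 𝟙 :^ 4))) refl q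
    X-suc (suc i) = eliminate (- (q ^ 2 * (Q * Q ^ i))) (X-suc i)
      (solve 5 (λ q w v x y → :- (x :* (q :^ 2 :* (q :^ 5 :* v))) :=
         :- ((:- (y :* (q :^ 3 :* v))) :* (q :^ 2 :* (q :* w) :^ 4))
         :+ (:- (q :^ 2 :* (q :^ 5 :* v))) :* (x :- (:- (y :* (q :^ 2 :* w :^ 4)))))
       refl q (q ^ i) (Q ^ i) (X (suc i)) (Y i))

    Θ : Carrier
    Θ = ∑ N (λ i → Y i * (1# - q ^ 2 * (q ^ i) ^ 4))

    Θ≈∑ : Θ ≈ ∑ N X + ∑ N Y - 1#
    Θ≈∑ = begin
      Θ
        ≈⟨ ∑-telescope N {g = λ i → X i + Y i} (λ i → - X i) (λ i _ → eliminate (- 1#) (X-suc i)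
             (solve 4 (λ x x' y s → y :* (𝟙 :- s) := x :+ y :+ (:- x :- :- x') :+ (:- 𝟙) :* (x' :- :- (y :* s)))
               refl (X i) (X (suc i)) (Y i) (q ^ 2 * (q ^ i) ^ 4))) ⟩
      ∑ N (λ i → X i + Y i) + (- 1# - - X N)
        ≈⟨ +-cong (∑-+ N X Y) (+-congˡ (-‿cong (-‿cong (theta-vanish Q ℕ.≤-refl (q∣q^ 1))))) ⟩
      ∑ N X + ∑ N Y + (- 1# - - 0#)
        ≈⟨ solve 1 (λ s → s :+ (:- 𝟙 :- :- 𝟘) := s :- 𝟙) refl (∑ N X + ∑ N Y) ⟩
      ∑ N X + ∑ N Y - 1# ∎

    jacobi : Θ ≈ poch (q ^ 2) Q (N ℕ.+ N) * poch (q ^ 3) Q N * poch Q Q N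
    jacobi = eliminate (- Θ) (poch-recip (q∣q^ 4) N)
      (eliminate (- poch Q Q N) (trans (sym (S≈poch (N ℕ.+ N))) (trans S-limit (*-congʳ (sym Θ≈∑))))
      (solve 4 (λ t p p' r → t := p :* p' :+ (:- t) :* (p' :* r :- 𝟙) :+ (:- p') :* (p :- t :* r)) refl
        Θ (poch (q ^ 2) Q (N ℕ.+ N) * poch (q ^ 3) Q N) (poch Q Q N) (recip Q N)))

    -- The first Rogers–Ramanujan identity

    weight ρ : Carrier → Carrier → Carrier
    weight z w = 1# - z * z * (q ^ 2 * w ^ 4)
    ρ z w = 1# + w + z * q * w ^ 3 - z * z * (q ^ 2 * w ^ 4)

    -- With z = qᵐ, w = qⁿ and t = qᵐⁿ this expresses the recurrence P-rec, summand
    -- by summand, as a telescoping difference in n.  The polynomial ρ was found by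
    -- comparing coefficients of w.
    certificate : ∀ z w Y t P₀ P₁ P₂ r r' →
      (1# - q * z) * P₁ ≈ P₀ * (1# - q * z * w) →
      (1# - q * (q * z)) * P₂ ≈ P₁ * (1# - q * (q * z) * w) →
      (1# - q * w) * r' ≈ r →
      Y * (t * t) * (P₀ * r) * weight z w
      ≈ (1# - q * z) * (Y * (w * t * (w * t)) * (P₁ * r) * weight (q * z) w)
        + q * z * (1# - q * z) * (1# - q * (q * z))
          * (Y * (w * (w * t) * (w * (w * t))) * (P₂ * r) * weight (q * (q * z)) w)
        + (Y * (t * t) * (P₀ * r) * (1# - w) * ρ z w
           - (- (Y * (q ^ 3 * w ^ 5))) * (z * t * (z * t)) * (P₀ * (1# - q * z * w) * r') * (1# - q * w) * ρ z (q * w))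
    certificate z w Y t P₀ P₁ P₂ r r' h₁ h₂ h₃ =
      -- Each cofactor is minus the coefficient with which the left side of its relation enters the
      -- right side of the goal. That of `h₁` has two summands because replacing P₂ by means of `h₂`
      -- creates another P₁.
      eliminate (- (Y * w ^ 2 * t ^ 2 * r * (weight (q * z) w + q * z * (1# - q * (q * z) * w) * w ^ 2 * weight (q * (q * z)) w))) h₁
      (eliminate (- (q * z * (1# - q * z) * Y * w ^ 4 * t ^ 2 * r * weight (q * (q * z)) w)) h₂
      (eliminate (- (Y * q ^ 3 * w ^ 5 * z ^ 2 * t ^ 2 * P₀ * (1# - q * z * w) * ρ z (q * w))) h₃
      (solve 10 (λ q z w Y t P₀ P₁ P₂ r r' →
        let weight = λ z w → 𝟙 :- z :* z :* (q :^ 2 :* w :^ 4)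
            ρ  = λ z w → 𝟙 :+ w :+ z :* q :* w :^ 3 :- z :* z :* (q :^ 2 :* w :^ 4)
            u  = 𝟙 :- q :* z
            v  = 𝟙 :- q :* (q :* z)
            u' = 𝟙 :- q :* z :* w
            v' = 𝟙 :- q :* (q :* z) :* w
        in
        Y :* (t :* t) :* (P₀ :* r) :* weight z w
        := u :* (Y :* (w :* t :* (w :* t)) :* (P₁ :* r) :* weight (q :* z) w)
          :+ q :* z :* u :* v :* (Y :* (w :* (w :* t) :* (w :* (w :* t))) :* (P₂ :* r) :* weight (q :* (q :* z)) w)
          :+ (Y :* (t :* t) :* (P₀ :* r) :* (𝟙 :- w) :* ρ z w
            :- (:- (Y :* (q :^ 3 :* w :^ 5))) :* (z :* t :* (z :* t)) :* (P₀ :* u' :* r') :* (𝟙 :- q :* w) :* ρ z (q :* w))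
          :+ (:- (Y :* w :^ 2 :* t :^ 2 :* r :* (weight (q :* z) w :+ q :* z :* v' :* w :^ 2 :* weight (q :* (q :* z)) w))) :* (u :* P₁ :- P₀ :* u')
          :+ (:- (q :* z :* u :* Y :* w :^ 4 :* t :^ 2 :* r :* weight (q :* (q :* z)) w)) :* (v :* P₂ :- P₁ :* v')
          :+ (:- (Y :* q :^ 3 :* w :^ 5 :* z :^ 2 :* t :^ 2 :* P₀ :* u' :* ρ z (q :* w))) :* ((𝟙 :- q :* w) :* r' :- r))
        refl q z w Y t P₀ P₁ P₂ r r')))

    q∣q : Divisible q
    q∣q = 1# , sym (*-identityʳ q)

    -- `U` is the telescoping certificate for `P-rec`. Its factor 1 - qⁿ makes it vanish at n = 0
    -- and absorbs the last denominator of `recip q n`; at n = N it vanishes with `Y`.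
    e U : ℕ → ℕ → Carrier
    e m n = Y n * (q ^ (m ℕ.* n) * q ^ (m ℕ.* n)) * (poch (q ^ suc m) q n * recip q n)
    U m n = e m n * (1# - q ^ n) * ρ (q ^ m) (q ^ n)

    -- Rogers' series for (q^(m+1); q)_∞ ∑ₙ q^(n²+mn) / (q; q)ₙ
    P : ℕ → Carrier
    P m = ∑ N (λ n → e m n * weight (q ^ m) (q ^ n))

    sq-cong : ∀ {x y} → x ≈ y → x * x ≈ y * y
    sq-cong x≈y = *-cong x≈y x≈y

    P-rec : ∀ m → P m ≈ (1# - q ^ suc m) * P (suc m)
                        + q ^ suc m * (1# - q ^ suc m) * (1# - q ^ suc (suc m)) * P (suc (suc m))
    P-rec m = begin
      P m
        ≈⟨ ∑-telescope N (U m) (λ n _ → step n) ⟩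
      ∑ N (λ n → a * T (suc m) n + b * T (suc (suc m)) n) + (U m 0 - U m N)
        ≈⟨ +-cong (trans (∑-+ N _ _) (+-cong (∑-* N a _) (∑-* N b _))) (+-cong U-first (-‿cong U-last)) ⟩
      a * P (suc m) + b * P (suc (suc m)) + (0# - 0#)
        ≈⟨ trans (+-congˡ (-‿inverseʳ 0#)) (+-identityʳ _) ⟩
      a * P (suc m) + b * P (suc (suc m)) ∎
      where
      a b : Carrier
      a = 1# - q ^ suc m
      b = q ^ suc m * (1# - q ^ suc m) * (1# - q ^ suc (suc m))
      T : ℕ → ℕ → Carrier
      T k n = e k n * weight (q ^ k) (q ^ n)
      U-first : U m 0 ≈ 0#
      U-first = *-zeroˡ (ρ (q ^ m) 1#) (*-zeroʳ (e m 0) (-‿inverseʳ 1#))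
      U-last : U m N ≈ 0#
      U-last = *-zeroˡ (ρ (q ^ m) (q ^ N)) (*-zeroˡ (1# - q ^ N)
        (*-zeroˡ (poch (q ^ suc m) q N * recip q N) (*-zeroˡ (q ^ (m ℕ.* N) * q ^ (m ℕ.* N)) (theta-vanish Q ℕ.≤-refl (q∣q^ 2)))))
      step : ∀ n → T m n ≈ (a * T (suc m) n + b * T (suc (suc m)) n) + (U m n - U m (suc n))
      step n = trans (certificate (q ^ m) w (Y n) t (poch (q ^ suc m) q n) (poch (q ^ suc (suc m)) q n)
          (poch (q ^ suc (suc (suc m))) q n) (recip q n) (recip q (suc n))
          (poch-shift (q ^ suc m) q n) (poch-shift (q ^ suc (suc m)) q n) (recip-suc q∣q n))
        (+-cong (+-cong
          (*-congˡ {a} (*-congʳ {weight (q ^ suc m) w} (*-congʳ {poch (q ^ suc (suc m)) q n * recip q n} (*-congˡ {Y n} (sq-cong wt)))))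
          (*-congˡ {b} (*-congʳ {weight (q ^ suc (suc m)) w}
            (*-congʳ {poch (q ^ suc (suc (suc m))) q n * recip q n} (*-congˡ {Y n} (sq-cong (trans (*-congˡ wt) (sym (^-homo-* q n (n ℕ.+ m ℕ.* n))))))))))
          (+-congˡ {U m n} (-‿cong (*-congʳ {ρ (q ^ m) (q ^ suc n)} (*-congʳ {1# - q ^ suc n}
            (*-congʳ {poch (q ^ suc m) q (suc n) * recip q (suc n)} (*-cong (-‿cong (*-congˡ {Y n} (*-congˡ {q ^ 3} w⁵))) (sq-cong zt))))))))
        where
        w t : Carrier
        w = q ^ n
        t = q ^ (m ℕ.* n)
        wt : w * t ≈ q ^ (n ℕ.+ m ℕ.* n)
        wt = sym (^-homo-* q n (m ℕ.* n))
        zt : q ^ m * t ≈ q ^ (m ℕ.* suc n)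
        zt = trans (sym (^-homo-* q m (m ℕ.* n))) (^-congʳ q (≡.sym (ℕ.*-suc m n)))
        w⁵ : w ^ 5 ≈ Q ^ n
        w⁵ = trans (^-assocʳ q n 5) (trans (^-congʳ q (ℕ.*-comm n 5)) (sym (^-assocʳ q 5 n)))

    P-limit : ∀ m → N ≤ m → P m ≈ 1#
    P-limit m N≤m = begin
      P m
        ≈⟨ ∑-head M (λ n → *-zeroˡ (weight (q ^ m) (q ^ suc n)) (*-zeroˡ (poch (q ^ suc m) q (suc n) * recip q (suc n))
             (*-zeroʳ (Y (suc n)) (*-zeroˡ (q ^ (m ℕ.* suc n)) (q^-vanish (ℕ.≤-trans N≤m (ℕ.m≤m*n m (suc n)))))))) ⟩
      1# * (q ^ (m ℕ.* 0) * q ^ (m ℕ.* 0)) * (1# * 1#) * weight (q ^ m) 1#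
        ≈⟨ *-cong (*-congʳ (*-congˡ (sq-cong (^-congʳ q (ℕ.*-zeroʳ m)))))
             (1-0 (*-zeroˡ (q ^ 2 * 1# ^ 4) (*-zeroˡ (q ^ m) (q^-vanish N≤m)))) ⟩
      1# * (1# * 1#) * (1# * 1#) * 1#
        ≈⟨ solve 0 (𝟙 :* (𝟙 :* 𝟙) :* (𝟙 :* 𝟙) :* 𝟙 := 𝟙) refl ⟩
      1# ∎

    P-zero : P 0 ≈ Θ
    P-zero = ∑-cong N (λ n _ → *-cong (begin
        Y n * (1# * 1#) * (poch (q * 1#) q n * recip q n)
          ≈⟨ *-congˡ (trans (*-congʳ (poch-cong q n (*-identityʳ q))) (poch-recip q∣q n)) ⟩
        Y n * (1# * 1#) * 1#
          ≈⟨ solve 1 (λ y → y :* (𝟙 :* 𝟙) :* 𝟙 := y) refl (Y n) ⟩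
        Y n ∎)
      (+-congˡ (-‿cong (trans (*-congʳ (*-identityʳ 1#)) (*-identityˡ _)))))

    E : ℕ → Carrier
    E m = poch (q ^ suc m) q N

    E-step : ∀ m → E m ≈ (1# - q ^ suc m) * E (suc m)
    E-step m = poch-step (q ^ suc m) q N (*-zeroʳ _ (q^-vanish ℕ.≤-refl))

    E-limit : ∀ m → N ≤ m → E m ≈ 1#
    E-limit m N≤m = poch-zero q N (q^-vanish (ℕ.m≤n⇒m≤1+n N≤m))

    sum-side : (A : ℕ → Carrier) → (∀ m → A m ≈ A (suc m) + q ^ suc m * A (suc (suc m))) →
               (∀ m → N ≤ m → A m ≈ 1#) → ∀ m → E m * A m ≈ P m
    sum-side A A-rec A-limit = descend N
      (λ m N≤m → trans (*-cong (E-limit m N≤m) (A-limit m N≤m)) (trans (*-identityʳ 1#) (sym (P-limit m N≤m))))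
      (λ m ih₁ ih₂ → trans (eliminate (E m) (A-rec m)
        (eliminate (A (suc m) + q ^ suc m * A (suc (suc m))) (E-step m)
        (eliminate ((1# - q ^ suc m) * q ^ suc m * A (suc (suc m))) (E-step (suc m))
        (eliminate (1# - q ^ suc m) ih₁
        (eliminate (q ^ suc m * (1# - q ^ suc m) * (1# - q ^ suc (suc m))) ih₂
        (solve 10 (λ q' q'' a₀ a₁ a₂ e₀ e₁ e₂ p₁ p₂ → e₀ :* a₀ :=
          (𝟙 :- q') :* p₁ :+ q' :* (𝟙 :- q') :* (𝟙 :- q'') :* p₂
          :+ e₀ :* (a₀ :- (a₁ :+ q' :* a₂))
          :+ (a₁ :+ q' :* a₂) :* (e₀ :- (𝟙 :- q') :* e₁)
          :+ (𝟙 :- q') :* q' :* a₂ :* (e₁ :- (𝟙 :- q'') :* e₂)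
          :+ (𝟙 :- q') :* (e₁ :* a₁ :- p₁)
          :+ q' :* (𝟙 :- q') :* (𝟙 :- q'') :* (e₂ :* a₂ :- p₂))
          refl (q ^ suc m) (q ^ suc (suc m)) (A m) (A (suc m)) (A (suc (suc m)))
            (E m) (E (suc m)) (E (suc (suc m))) (P (suc m)) (P (suc (suc m)))))))))
        (sym (P-rec m)))

    -- The factors of (q²; Q)_∞ (q³; Q)_∞ (Q; Q)_∞ with exponent above 5i. The length `N ℕ.+ N` of
    -- the first product makes `Z 0` agree literally with `jacobi`.
    Z : ℕ → Carrier
    Z i = poch (q ^ (2 ℕ.+ i ℕ.* 5)) Q (N ℕ.+ N) * poch (q ^ (3 ℕ.+ i ℕ.* 5)) Q N * poch (q ^ (5 ℕ.+ i ℕ.* 5)) Q N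

    poch-step₅ : ∀ k n → N ≤ n → poch (q ^ k) Q n ≈ (1# - q ^ k) * poch (q ^ (5 ℕ.+ k)) Q n
    poch-step₅ k n N≤n = trans (poch-step (q ^ k) Q n (*-zeroʳ _ (divisible-^ n N≤n (q∣q^ 4))))
      (*-congˡ (poch-cong Q n (sym (^-homo-* q 5 k))))

    -- Five factors of `E` are split off at a time: exponents congruent to 1 and 4 carry B from 5i
    -- to 5i + 5, and those congruent to 2, 3 and 0 extend the three products in `Z`.
    product-side : (B : ℕ → Carrier) →
      (∀ i → (1# - q ^ (1 ℕ.+ i ℕ.* 5)) * (1# - q ^ (4 ℕ.+ i ℕ.* 5)) * B (i ℕ.* 5) ≈ B (suc i ℕ.* 5)) →
      (∀ m → N ≤ m → B m ≈ 1#) → ∀ i → E (i ℕ.* 5) * B (i ℕ.* 5) ≈ Z i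
    product-side B B-step B-limit = descend N base step
      where
      base : ∀ i → N ≤ i → E (i ℕ.* 5) * B (i ℕ.* 5) ≈ Z i
      base i N≤i = begin
        E k * B k       ≈⟨ *-cong (E-limit k N≤k) (B-limit k N≤k) ⟩
        1# * 1#         ≈⟨ *-identityˡ _ ⟨
        1# * (1# * 1#)  ≈⟨ *-assoc _ _ _ ⟨
        1# * 1# * 1#    ≈⟨ *-cong (*-cong (one 2 (N ℕ.+ N)) (one 3 N)) (one 5 N) ⟨
        Z i             ∎
        where
        k = i ℕ.* 5
        N≤k = ℕ.≤-trans N≤i (ℕ.m≤m*n i 5)
        one : ∀ j n → poch (q ^ (j ℕ.+ k)) Q n ≈ 1#
        one j n = poch-zero Q n (q^-vanish (ℕ.≤-trans N≤k (ℕ.m≤n+m k j)))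
      step : ∀ i → E (suc i ℕ.* 5) * B (suc i ℕ.* 5) ≈ Z (suc i) → _ → E (i ℕ.* 5) * B (i ℕ.* 5) ≈ Z i
      step i ih _ = begin
        E k * B k
          ≈⟨ *-congʳ (trans (E-step k) (*-congˡ (trans (E-step (1 ℕ.+ k)) (*-congˡ (trans (E-step (2 ℕ.+ k))
               (*-congˡ (trans (E-step (3 ℕ.+ k)) (*-congˡ (E-step (4 ℕ.+ k)))))))))) ⟩
        f 1 * (f 2 * (f 3 * (f 4 * (f 5 * E (5 ℕ.+ k))))) * B k
          ≈⟨ solve 7 (λ f₁ f₂ f₃ f₄ f₅ e b → f₁ :* (f₂ :* (f₃ :* (f₄ :* (f₅ :* e)))) :* b :=
               f₂ :* f₃ :* f₅ :* (e :* (f₁ :* f₄ :* b))) refl (f 1) (f 2) (f 3) (f 4) (f 5) (E (5 ℕ.+ k)) (B k) ⟩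
        f 2 * f 3 * f 5 * (E (5 ℕ.+ k) * (f 1 * f 4 * B k))
          ≈⟨ *-congˡ (trans (*-congˡ (B-step i)) ih) ⟩
        f 2 * f 3 * f 5 * Z (suc i)
          ≈⟨ solve 6 (λ f₂ f₃ f₅ x y z → f₂ :* f₃ :* f₅ :* (x :* y :* z) := f₂ :* x :* (f₃ :* y) :* (f₅ :* z))
               refl (f 2) (f 3) (f 5) (poch (q ^ (7 ℕ.+ k)) Q (N ℕ.+ N)) (poch (q ^ (8 ℕ.+ k)) Q N) (poch (q ^ (10 ℕ.+ k)) Q N) ⟩
        f 2 * poch (q ^ (7 ℕ.+ k)) Q (N ℕ.+ N) * (f 3 * poch (q ^ (8 ℕ.+ k)) Q N) * (f 5 * poch (q ^ (10 ℕ.+ k)) Q N)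
          ≈⟨ *-cong (*-cong (poch-step₅ (2 ℕ.+ k) (N ℕ.+ N) (ℕ.m≤m+n N N)) (poch-step₅ (3 ℕ.+ k) N ℕ.≤-refl))
               (poch-step₅ (5 ℕ.+ k) N ℕ.≤-refl) ⟨
        Z i ∎
        where
        k = i ℕ.* 5
        f : ℕ → Carrier
        f j = 1# - q ^ (j ℕ.+ k)

    -- `E 0` is (q; q)_∞, with inverse `recip q N`, so it can be cancelled from the common value
    -- `Z 0` of both sides.
    rogersRamanujan : (A B : ℕ → Carrier) →
      (∀ m → A m ≈ A (suc m) + q ^ suc m * A (suc (suc m))) →
      (∀ m → N ≤ m → A m ≈ 1#) →
      (∀ i → (1# - q ^ (1 ℕ.+ i ℕ.* 5)) * (1# - q ^ (4 ℕ.+ i ℕ.* 5)) * B (i ℕ.* 5) ≈ B (suc i ℕ.* 5)) →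
      (∀ m → N ≤ m → B m ≈ 1#) →
      A 0 ≈ B 0
    rogersRamanujan A B A-rec A-limit B-step B-limit = begin
      A 0                         ≈⟨ *-identityˡ _ ⟨
      1# * A 0                    ≈⟨ *-congʳ unit ⟨
      recip q N * E 0 * A 0       ≈⟨ *-assoc _ _ _ ⟩
      recip q N * (E 0 * A 0)     ≈⟨ *-congˡ (trans (sum-side A A-rec A-limit 0) (trans P-zero jacobi)) ⟩
      recip q N * Z 0             ≈⟨ *-congˡ (product-side B B-step B-limit 0) ⟨
      recip q N * (E 0 * B 0)     ≈⟨ *-assoc _ _ _ ⟨
      recip q N * E 0 * B 0       ≈⟨ *-congʳ unit ⟩
      1# * B 0                    ≈⟨ *-identityˡ _ ⟩
      B 0                         ∎
      where
      unit : recip q N * E 0 ≈ 1#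
      unit = trans (*-comm _ _) (trans (*-congʳ (poch-cong q N (*-identityʳ q))) (poch-recip q∣q N))

-- Formal power series over ℤ and their truncations

module PowerSeries where

  open import Data.Integer.Tactic.RingSolver using (solve-∀)
  open import Relation.Binary.PropositionalEquality using (cong; cong₂)

  Series : Set
  Series = ℕ → ℤ

  infixl 6 _⊕_
  infixl 7 _⊛_

  _⊕_ _⊛_ : Series → Series → Series
  (f ⊕ g) n = f n ℤ.+ g n
  (f ⊛ g) zero    = f 0 ℤ.* g 0
  (f ⊛ g) (suc n) = f 0 ℤ.* g (suc n) ℤ.+ (f ∘ suc ⊛ g) n

  0ₛ 1ₛ q : Series
  0ₛ _ = + 0
  1ₛ zero    = + 1
  1ₛ (suc _) = + 0
  q zero    = + 0
  q (suc n) = 1ₛ n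

  ⊛-cong : ∀ {f f' g g'} n → (∀ k → k ≤ n → f k ≡ f' k) → (∀ k → k ≤ n → g k ≡ g' k) → (f ⊛ g) n ≡ (f' ⊛ g') n
  ⊛-cong zero    f≡ g≡ = cong₂ ℤ._*_ (f≡ 0 z≤n) (g≡ 0 z≤n)
  ⊛-cong (suc n) f≡ g≡ = cong₂ ℤ._+_ (cong₂ ℤ._*_ (f≡ 0 z≤n) (g≡ (suc n) ℕ.≤-refl))
    (⊛-cong n (λ k k≤n → f≡ (suc k) (s≤s k≤n)) (λ k k≤n → g≡ k (ℕ.m≤n⇒m≤1+n k≤n)))

  ⊛-distribʳ : ∀ h f g → (f ⊕ g) ⊛ h ≗ (f ⊛ h) ⊕ (g ⊛ h)
  ⊛-distribʳ h f g zero    = ℤ.*-distribʳ-+ (h 0) (f 0) (g 0)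
  ⊛-distribʳ h f g (suc n) rewrite ⊛-distribʳ h (f ∘ suc) (g ∘ suc) n = lemma (f 0) (g 0) (h (suc n)) _ _
    where
    lemma : ∀ a b c d e → (a ℤ.+ b) ℤ.* c ℤ.+ (d ℤ.+ e) ≡ (a ℤ.* c ℤ.+ d) ℤ.+ (b ℤ.* c ℤ.+ e)
    lemma = solve-∀

  -- The definition of `⊛` recurses on the left factor; this is the mirror-image recursion on the
  -- right one, which is what commutativity needs.
  ⊛-suc : ∀ f g n → (f ⊛ g) (suc n) ≡ (f ⊛ g ∘ suc) n ℤ.+ f (suc n) ℤ.* g 0
  ⊛-suc f g zero    = ≡.refl
  ⊛-suc f g (suc n) rewrite ⊛-suc (f ∘ suc) g n =
    ≡.sym (ℤ.+-assoc (f 0 ℤ.* g (suc (suc n))) ((f ∘ suc ⊛ g ∘ suc) n) (f (suc (suc n)) ℤ.* g 0))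

  ⊛-comm : ∀ f g → f ⊛ g ≗ g ⊛ f
  ⊛-comm f g zero    = ℤ.*-comm (f 0) (g 0)
  ⊛-comm f g (suc n) rewrite ⊛-suc g f n | ⊛-comm (f ∘ suc) g n =
    lemma (f 0) (g (suc n)) ((g ⊛ f ∘ suc) n)
    where
    lemma : ∀ a b c → a ℤ.* b ℤ.+ c ≡ c ℤ.+ b ℤ.* a
    lemma = solve-∀

  ⊛-scale : ∀ a f g → (λ n → a ℤ.* f n) ⊛ g ≗ λ n → a ℤ.* (f ⊛ g) n
  ⊛-scale a f g zero    = ℤ.*-assoc a (f 0) (g 0)
  ⊛-scale a f g (suc n) rewrite ⊛-scale a (f ∘ suc) g n = lemma a (f 0) (g (suc n)) ((f ∘ suc ⊛ g) n)
    where
    lemma : ∀ a b c d → a ℤ.* b ℤ.* c ℤ.+ a ℤ.* d ≡ a ℤ.* (b ℤ.* c ℤ.+ d)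
    lemma = solve-∀

  ⊛-assoc : ∀ f g h → (f ⊛ g) ⊛ h ≗ f ⊛ (g ⊛ h)
  ⊛-assoc f g h zero    = ℤ.*-assoc (f 0) (g 0) (h 0)
  ⊛-assoc f g h (suc n)
    -- By computation `(f ⊛ g) ∘ suc` is a multiple of `g ∘ suc` plus `f ∘ suc ⊛ g`; the rewrites
    -- treat these two summands separately.
    rewrite ⊛-distribʳ h (λ n → f 0 ℤ.* g (suc n)) (f ∘ suc ⊛ g) n
          | ⊛-scale (f 0) (g ∘ suc) h n
          | ⊛-assoc (f ∘ suc) g h n = lemma (f 0) (g 0) (h (suc n)) _ _
    where
    lemma : ∀ a b c d e → a ℤ.* b ℤ.* c ℤ.+ (a ℤ.* d ℤ.+ e) ≡ a ℤ.* (b ℤ.* c ℤ.+ d) ℤ.+ e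
    lemma = solve-∀

  ⊛-zeroˡ : ∀ f → 0ₛ ⊛ f ≗ 0ₛ
  ⊛-zeroˡ f zero    = ≡.refl
  ⊛-zeroˡ f (suc n) rewrite ⊛-zeroˡ f n = ≡.refl

  ⊛-identityˡ : ∀ f → 1ₛ ⊛ f ≗ f
  ⊛-identityˡ f zero    = ℤ.*-identityˡ (f 0)
  ⊛-identityˡ f (suc n) rewrite ⊛-zeroˡ f n = ≡.trans (ℤ.+-identityʳ _) (ℤ.*-identityˡ (f (suc n)))

  -- ℤ[[q]]/(q^N)
  module Truncated (N : ℕ) where

    infix 4 _≈_

    _≈_ : Series → Series → Set
    f ≈ g = ∀ k → k < N → f k ≡ g k

    ≗⇒≈ : ∀ {f g} → f ≗ g → f ≈ g
    ≗⇒≈ f≗g k _ = f≗g k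

    isCommutativeRing : IsCommutativeRing _≈_ _⊕_ _⊛_ (ℤ.-_ ∘_) 0ₛ 1ₛ
    isCommutativeRing = record
      { isRing = record
        { +-isAbelianGroup = record
          { isGroup = record
            { isMonoid = record
              { isSemigroup = record
                { isMagma = record
                  { isEquivalence = record
                    { refl  = λ _ _ → ≡.refl
                    ; sym   = λ f≈g k k<N → ≡.sym (f≈g k k<N)
                    ; trans = λ f≈g g≈h k k<N → ≡.trans (f≈g k k<N) (g≈h k k<N)
                    }
                  ; ∙-cong = λ f≈f' g≈g' k k<N → cong₂ ℤ._+_ (f≈f' k k<N) (g≈g' k k<N)
                  }
                ; assoc = λ f g h k _ → ℤ.+-assoc (f k) (g k) (h k)
                }
              ; identity = (λ f k _ → ℤ.+-identityˡ (f k)) , (λ f k _ → ℤ.+-identityʳ (f k))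
              }
            ; inverse = (λ f k _ → ℤ.+-inverseˡ (f k)) , (λ f k _ → ℤ.+-inverseʳ (f k))
            ; ⁻¹-cong = λ f≈g k k<N → cong ℤ.-_ (f≈g k k<N)
            }
          ; comm = λ f g k _ → ℤ.+-comm (f k) (g k)
          }
        ; *-cong = λ f≈f' g≈g' k k<N → ⊛-cong k
            (λ i i≤k → f≈f' i (ℕ.≤-<-trans i≤k k<N)) (λ i i≤k → g≈g' i (ℕ.≤-<-trans i≤k k<N))
        ; *-assoc = λ f g h → ≗⇒≈ (⊛-assoc f g h)
        ; *-identity = (λ f → ≗⇒≈ (⊛-identityˡ f)) , (λ f → ≗⇒≈ λ n → ≡.trans (⊛-comm f 1ₛ n) (⊛-identityˡ f n))
        ; distrib = (λ f g h → ≗⇒≈ λ n → ≡.trans (⊛-comm f (g ⊕ h) n) (≡.trans (⊛-distribʳ f g h n)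
                      (cong₂ ℤ._+_ (⊛-comm g f n) (⊛-comm h f n))))
                  , (λ f g h → ≗⇒≈ (⊛-distribʳ f g h))
        }
      ; *-comm = λ f g → ≗⇒≈ (⊛-comm f g)
      }

    commutativeRing : CommutativeRing 0ℓ 0ℓ
    commutativeRing = record { isCommutativeRing = isCommutativeRing }

  -- Multiplication by q^c, with 0# filling the low coefficients.
  shift : {A : Set} → A → ℕ → (ℕ → A) → ℕ → A
  shift 0# zero    f n       = f n
  shift 0# (suc c) f zero    = 0#
  shift 0# (suc c) f (suc n) = shift 0# c f n

  module _ (N : ℕ) where
    open Truncated N
    open CommutativeRing commutativeRing using (semiring)
    open import Algebra.Properties.Semiring.Exp semiring using (_^_)

    q^-⊛ : ∀ c f → q ^ c ⊛ f ≗ shift (+ 0) c f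
    q^-⊛ zero    f n = ⊛-identityˡ f n
    q^-⊛ (suc c) f n = ≡.trans (⊛-assoc q (q ^ c) f n) (step n)
      where
      step : q ⊛ (q ^ c ⊛ f) ≗ shift (+ 0) (suc c) f
      step zero    = ≡.refl
      step (suc n) = ≡.trans (ℤ.+-identityˡ _) (≡.trans (⊛-identityˡ (q ^ c ⊛ f) n) (q^-⊛ c f n))

    q^N≈0 : q ^ N ≈ 0ₛ
    q^N≈0 k k<N = ≡.trans (≡.sym (≡.trans (⊛-comm (q ^ N) 1ₛ k) (⊛-identityˡ (q ^ N) k)))
      (≡.trans (q^-⊛ N 1ₛ k) (low N k k<N))
      where
      low : ∀ c k → k < c → shift (+ 0) c 1ₛ k ≡ + 0
      low (suc c) zero    _         = ≡.refl
      low (suc c) (suc k) (s≤s k<c) = low c k k<c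

open PowerSeries

-- Counting partitions by removing a part

module Counting where

  open import Data.Bool using (true; false)
  open import Data.Fin using (Fin; zero; suc; toℕ)
  open import Data.Fin.Properties using (all?)
  open import Data.List using (_++_; map; filter; length; lookup)
  open import Data.List.Membership.Propositional using (_∈_; _∉_)
  open import Data.List.Membership.Propositional.Properties
    using (∈-map⁺; ∈-map⁻; ∈-++⁺ˡ; ∈-++⁺ʳ; ∈-++⁻; ∈-filter⁺; ∈-filter⁻; ∈-lookup)
  open import Data.List.Membership.Propositional.Properties.WithK using (unique∧set⇒bag)
  open import Data.List.Membership.DecPropositional ℕ._≟_ using (_∈?_)
  open import Data.List.Properties using (length-map; length-++; ∷-injectiveˡ; ∷-injectiveʳ; filter-accept; filter-reject)
  open import Data.List.Relation.Binary.BagAndSetEquality using (∼bag⇒↭)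
  open import Data.List.Relation.Binary.Permutation.Propositional using (_↭_; ↭-sym; ↭⇒↭ₛ)
  open import Data.List.Relation.Binary.Permutation.Propositional.Properties using (↭-length; All-resp-↭; ∈-resp-↭)
  open import Data.List.Relation.Binary.Permutation.Setoid.Properties using (Unique-resp-↭)
  open import Data.List.Relation.Unary.AllPairs as AllPairs using ([]; _∷_)
  open import Data.List.Relation.Unary.Any using (here; there)
  open import Data.List.Relation.Unary.Linked using (Linked; [-]; _∷_)
  open import Data.List.Relation.Unary.Linked.Properties using (AllPairs⇒Linked; Linked⇒AllPairs)
  open import Data.List.Relation.Unary.Unique.Propositional using (Unique)
  import Data.List.Relation.Unary.Unique.Propositional.Properties as Unique
  open import Data.List.Sort.InsertionSort.Base ℕ.≤-decTotalOrder using (insert)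
  open import Data.List.Sort.InsertionSort.Properties ℕ.≤-decTotalOrder using (insert-↭; insert-↗)
  open import Data.Nat
  open import Data.Nat.ListAction using (sum)
  open import Data.Nat.ListAction.Properties using (sum-↭)
  open import Data.Nat.Properties
  open import Data.Nat.Tactic.RingSolver using (solve-∀)
  open import Function.Bundles using (mk⇔; Equivalence)
  open import Relation.Binary.PropositionalEquality hiding ([_])
  open import Relation.Nullary.Decidable using (_×-dec_; _→-dec_)
  open import Relation.Nullary.Reflects using (ofʸ; ofⁿ)

  unique-resp-↭ : {xs ys : List ℕ} → xs ↭ ys → Unique xs → Unique ys
  unique-resp-↭ = Unique-resp-↭ (setoid ℕ) ∘ ↭⇒↭ₛ

  same-length : {X : Set} {xs ys : List X} → Unique xs → Unique ys →
                (∀ {x} → x ∈ xs → x ∈ ys) → (∀ {x} → x ∈ ys → x ∈ xs) → length xs ≡ length ys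
  same-length u v to from = ↭-length (∼bag⇒↭ (unique∧set⇒bag u v (mk⇔ to from)))

  Ascending : Pred (List ℕ) 0ℓ
  Ascending xs = All (0 <_) xs × Linked _≤_ xs

  private
    variable
      P Q R : Pred (List ℕ) 0ℓ

  counted : Decidable P → ℕ → List (List ℕ)
  counted P? n = filter P? (partitions n)

  ∈-counted⁻ : ∀ (P? : Decidable P) n {xs} → xs ∈ counted P? n → Ascending xs × P xs × sum xs ≡ n
  ∈-counted⁻ P? n xs∈ with ∈-filter⁻ P? {xs = partitions n} xs∈
  ... | xs∈p , p with Equivalence.to (∈-partitions n) xs∈p
  ...   | pos , asc , s = (pos , asc) , p , s

  ∈-counted⁺ : ∀ (P? : Decidable P) n {xs} → Ascending xs → P xs → sum xs ≡ n → xs ∈ counted P? n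
  ∈-counted⁺ P? n (pos , asc) p s = ∈-filter⁺ P? (Equivalence.from (∈-partitions n) (pos , asc , s)) p

  counted-unique : ∀ (P? : Decidable P) n → Unique (counted P? n)
  counted-unique P? n = Unique.filter⁺ P? (partitions-unique n)

  count-cong : (P? : Decidable P) (Q? : Decidable Q) →
               (∀ {xs} → Ascending xs → P xs → Q xs) → (∀ {xs} → Ascending xs → Q xs → P xs) →
               ∀ n → count P? n ≡ count Q? n
  count-cong P? Q? to from n = same-length (counted-unique P? n) (counted-unique Q? n)
    (λ xs∈ → let asc , p , s = ∈-counted⁻ P? n xs∈ in ∈-counted⁺ Q? n asc (to asc p) s)
    (λ xs∈ → let asc , p , s = ∈-counted⁻ Q? n xs∈ in ∈-counted⁺ P? n asc (from asc p) s)

  module _ {X : Set} (L : ℕ → List X) where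

    shift-length : ∀ c n → length (shift [] c L n) ≡ shift 0 c (length ∘ L) n
    shift-length zero    n       = refl
    shift-length (suc c) zero    = refl
    shift-length (suc c) (suc n) = shift-length c n

    shift-unique : (∀ n → Unique (L n)) → ∀ c n → Unique (shift [] c L n)
    shift-unique u zero    n       = u n
    shift-unique u (suc c) zero    = []
    shift-unique u (suc c) (suc n) = shift-unique u c n

    ∈-shift⁻ : ∀ c n {x} → x ∈ shift [] c L n → ∃ λ k → n ≡ c + k × x ∈ L k
    ∈-shift⁻ zero    n       x∈ = n , refl , x∈
    ∈-shift⁻ (suc c) (suc n) x∈ with ∈-shift⁻ c n x∈
    ... | k , refl , x∈k = k , refl , x∈k

    ∈-shift⁺ : ∀ c k {x} → x ∈ L k → x ∈ shift [] c L (c + k)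
    ∈-shift⁺ zero    k x∈ = x∈
    ∈-shift⁺ (suc c) k x∈ = ∈-shift⁺ c k x∈

  -- The common source of the counting recurrences: `f` puts back a removed part of size c. The two
  -- enumerations are duplicate-free with the same members, so their lengths agree without an
  -- explicit bijection of positions.
  count-split :
    (P? : Decidable P) (Q? : Decidable Q) (R? : Decidable R) (c : ℕ) (f : List ℕ → List ℕ) →
    (∀ {xs ys} → f xs ≡ f ys → xs ≡ ys) → (∀ ys → sum (f ys) ≡ c + sum ys) →
    (∀ {xs} → Ascending xs → P xs → Q xs ⊎ ∃ λ ys → Ascending ys × R ys × xs ≡ f ys) →
    (∀ {xs} → Ascending xs → Q xs → P xs) →
    (∀ {ys} → Ascending ys → R ys → Ascending (f ys) × P (f ys) × ¬ Q (f ys)) →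
    ∀ n → count P? n ≡ count Q? n + shift 0 c (count R?) n
  count-split P? Q? R? c f f-injective f-sum split fromQ fromR n = begin
    count P? n
      ≡⟨ same-length (counted-unique P? n)
           (Unique.++⁺ (counted-unique Q? n) (Unique.map⁺ f-injective (shift-unique (counted R?) (counted-unique R?) c n)) disjoint)
           to from ⟩
    length (counted Q? n ++ map f (shift [] c (counted R?) n))
      ≡⟨ length-++ (counted Q? n) ⟩
    count Q? n + length (map f (shift [] c (counted R?) n))
      ≡⟨ cong (λ k → count Q? n + k) (trans (length-map f (shift [] c (counted R?) n)) (shift-length (counted R?) c n)) ⟩
    count Q? n + shift 0 c (count R?) n ∎
    where
    open ≡-Reasoning
    disjoint : ∀ {xs} → ¬ (xs ∈ counted Q? n × xs ∈ map f (shift [] c (counted R?) n))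
    disjoint (xs∈Q , xs∈R) with ∈-map⁻ f xs∈R
    ... | ys , ys∈ , refl with ∈-shift⁻ (counted R?) c n ys∈
    ...   | k , _ , ys∈k = let asc , r , _ = ∈-counted⁻ R? k ys∈k
                               _ , q , _ = ∈-counted⁻ Q? n xs∈Q
                           in proj₂ (proj₂ (fromR asc r)) q
    to : ∀ {xs} → xs ∈ counted P? n → xs ∈ counted Q? n ++ map f (shift [] c (counted R?) n)
    to xs∈ with ∈-counted⁻ P? n xs∈
    ... | asc , p , s with split asc p
    ...   | inj₁ q = ∈-++⁺ˡ (∈-counted⁺ Q? n asc q s)
    ...   | inj₂ (ys , ascʸ , r , refl) rewrite trans (sym s) (f-sum ys) =
              ∈-++⁺ʳ _ (∈-map⁺ f (∈-shift⁺ (counted R?) c (sum ys) (∈-counted⁺ R? (sum ys) ascʸ r refl)))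
    from : ∀ {xs} → xs ∈ counted Q? n ++ map f (shift [] c (counted R?) n) → xs ∈ counted P? n
    from xs∈ with ∈-++⁻ (counted Q? n) xs∈
    ... | inj₁ xs∈Q = let asc , q , s = ∈-counted⁻ Q? n xs∈Q in ∈-counted⁺ P? n asc (fromQ asc q) s
    ... | inj₂ xs∈R with ∈-map⁻ f xs∈R
    ...   | ys , ys∈ , refl with ∈-shift⁻ (counted R?) c n ys∈
    ...     | k , n≡c+k , ys∈k = let asc , r , s = ∈-counted⁻ R? k ys∈k
                                     ascf , p , _ = fromR asc r
                                 in ∈-counted⁺ P? n ascf p (trans (f-sum ys) (trans (cong (λ m → c + m) s) (sym n≡c+k)))

  count-zero : (P? : Decidable P) → P [] → count P? 0 ≡ 1
  count-zero P? p[] with P? []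
  ... | yes _  = refl
  ... | no ¬p = contradiction p[] ¬p

  count-small : (P? : Decidable P) → ∀ m → (∀ {xs} → Ascending xs → P xs → All (m <_) xs) →
                ∀ n → suc n ≤ m → count P? (suc n) ≡ 0
  count-small P? m bound n n<m with counted P? (suc n) in eq
  ... | []     = refl
  ... | xs ∷ _ with ∈-counted⁻ P? (suc n) (subst (xs ∈_) (sym eq) (here refl))
  ...   | asc , p , s with xs | bound asc p
  ...     | x ∷ ys | m<x ∷ _ = contradiction (≤-trans (m≤m+n x (sum ys)) (≤-reflexive s)) (<⇒≱ (≤-<-trans n<m m<x))

  ascending-tail : ∀ {x xs} → Ascending (x ∷ xs) → Ascending xs × All (x ≤_) xs
  ascending-tail (_ ∷ pos , asc) with Linked⇒AllPairs ≤-trans asc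
  ... | x≤ ∷ asc' = (pos , AllPairs⇒Linked asc') , x≤

  ascending-∷ : ∀ {x xs} → 0 < x → All (x ≤_) xs → Ascending xs → Ascending (x ∷ xs)
  ascending-∷ 0<x x≤ (pos , asc) = 0<x ∷ pos , AllPairs⇒Linked (x≤ ∷ Linked⇒AllPairs ≤-trans asc)

  insert-≤ : ∀ {c xs} → All (c ≤_) xs → insert c xs ≡ c ∷ xs
  insert-≤ [] = refl
  insert-≤ {c} {x ∷ xs} (c≤x ∷ _) with c ≤ᵇ x | ≤ᵇ-reflects-≤ c x
  ... | true  | _       = refl
  ... | false | ofⁿ c≰x = contradiction c≤x c≰x

  insert-> : ∀ {c x xs} → x < c → insert c (x ∷ xs) ≡ x ∷ insert c xs
  insert-> {c} {x} x<c with c ≤ᵇ x | ≤ᵇ-reflects-≤ c x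
  ... | true  | ofʸ c≤x = contradiction c≤x (<⇒≱ x<c)
  ... | false | _       = refl

  insert-injective : ∀ c {xs ys} → insert c xs ≡ insert c ys → xs ≡ ys
  insert-injective c {[]} {[]} _ = refl
  insert-injective c {[]} {y ∷ ys} eq with c ≤ᵇ y | ≤ᵇ-reflects-≤ c y
  ... | true  | _       = contradiction (∷-injectiveʳ eq) λ ()
  ... | false | ofⁿ c≰y = contradiction (≤-reflexive (∷-injectiveˡ eq)) c≰y
  insert-injective c {x ∷ xs} {[]} eq with c ≤ᵇ x | ≤ᵇ-reflects-≤ c x
  ... | true  | _       = contradiction (∷-injectiveʳ eq) λ ()
  ... | false | ofⁿ c≰x = contradiction (≤-reflexive (sym (∷-injectiveˡ eq))) c≰x
  insert-injective c {x ∷ xs} {y ∷ ys} eq with c ≤ᵇ x | ≤ᵇ-reflects-≤ c x | c ≤ᵇ y | ≤ᵇ-reflects-≤ c y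
  ... | true  | _        | true  | _        = ∷-injectiveʳ eq
  ... | true  | _        | false | ofⁿ c≰y = contradiction (≤-reflexive (∷-injectiveˡ eq)) c≰y
  ... | false | ofⁿ c≰x | true  | _        = contradiction (≤-reflexive (sym (∷-injectiveˡ eq))) c≰x
  ... | false | _        | false | _        = cong₂ _∷_ (∷-injectiveˡ eq) (insert-injective c (∷-injectiveʳ eq))

  filter-insert : {D : Pred ℕ 0ℓ} (D? : Decidable D) → ∀ {c} → ¬ D c → ∀ xs → filter D? (insert c xs) ≡ filter D? xs
  filter-insert D? ¬Dc [] = filter-reject D? ¬Dc
  filter-insert D? {c} ¬Dc (x ∷ xs) with c ≤ᵇ x
  ... | true = filter-reject D? ¬Dc
  ... | false with D? x
  ...   | yes Dx = cong (x ∷_) (filter-insert D? ¬Dc xs)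
  ...   | no ¬Dx = filter-insert D? ¬Dc xs

  filter-insert-head : {D : Pred ℕ 0ℓ} (D? : Decidable D) → ∀ {c xs} → D c → All (λ x → D x → c ≤ x) xs →
                       filter D? (insert c xs) ≡ c ∷ filter D? xs
  filter-insert-head D? Dc [] = filter-accept D? Dc
  filter-insert-head D? {c} {x ∷ xs} Dc (c≤ ∷ c≤xs) with c ≤ᵇ x | ≤ᵇ-reflects-≤ c x
  ... | true  | _       = filter-accept D? Dc
  ... | false | ofⁿ c≰x = trans (filter-reject D? (c≰x ∘ c≤))
    (trans (filter-insert-head D? Dc c≤xs) (cong (c ∷_) (sym (filter-reject D? (c≰x ∘ c≤)))))

  -- A removed monomer need not be the least part, so it is put back by sorted insertion. An
  -- ascending list is determined by its entries, hence reinsertion restores the original list.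
  uninsert : ∀ {c xs} → Ascending xs → c ∈ xs → ∃ λ ys → Ascending ys × xs ≡ insert c ys
  uninsert {c} {x ∷ xs} asc c∈ with ascending-tail asc | x ≟ c
  ... | asc' , x≤ | yes refl = xs , asc' , sym (insert-≤ x≤)
  uninsert asc (here refl) | _ | no x≢c = contradiction refl x≢c
  uninsert {c} {x ∷ xs} (px ∷ _ , _) (there c∈) | asc' , x≤ | no x≢c with uninsert asc' c∈
  ... | ys , ascʸ , refl = x ∷ ys
        , ascending-∷ px (All.tail (All-resp-↭ (insert-↭ c ys) x≤)) ascʸ
        , sym (insert-> (≤∧≢⇒< (All.lookup x≤ c∈) x≢c))

  insert-ascending : ∀ {c xs} → 0 < c → Ascending xs → Ascending (insert c xs)
  insert-ascending {c} {xs} 0<c (pos , asc) = All-resp-↭ (↭-sym (insert-↭ c xs)) (0<c ∷ pos) , insert-↗ c asc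

  sum-insert : ∀ c xs → sum (insert c xs) ≡ c + sum xs
  sum-insert c xs = sum-↭ (insert-↭ c xs)

  -- Recurrences for the gap condition and for residues modulo 5

  Above : ℕ → Pred (List ℕ) 0ℓ
  Above m = All (m <_)

  above? : ∀ m → Decidable (Above m)
  above? m = All.all? (m <?_)

  gapAbove? : ∀ m → Decidable (λ xs → Above m xs × GapCondition xs)
  gapAbove? m xs = above? m xs ×-dec gapCondition? xs

  mod5Above? : ∀ m → Decidable (λ xs → Above m xs × Mod5Condition xs)
  mod5Above? m xs = above? m xs ×-dec mod5Condition? xs

  least : ∀ {m xs} → Ascending xs → Above m xs →
          Above (suc m) xs ⊎ ∃ λ ys → xs ≡ suc m ∷ ys × Ascending ys × Above m ys
  least _ [] = inj₁ []
  least {m} {x ∷ xs} asc (m<x ∷ m<xs) with suc m ≟ x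
  ... | yes refl = inj₂ (xs , refl , proj₁ (ascending-tail asc) , m<xs)
  ... | no m+1≢x = inj₁ (m+1<x ∷ All.map (<-≤-trans m+1<x) (proj₂ (ascending-tail asc)))
    where m+1<x = ≤∧≢⇒< m<x m+1≢x

  gap-step : ∀ m n → count (gapAbove? m) n ≡
             count (gapAbove? (suc m)) n + shift 0 (suc m) (count (gapAbove? (suc (suc m)))) n
  gap-step m = count-split (gapAbove? m) (gapAbove? (suc m)) (gapAbove? (suc (suc m))) (suc m) (suc m ∷_)
    ∷-injectiveʳ (λ _ → refl) split
    (λ _ (m<xs , gap) → All.map <⇒≤ m<xs , gap)
    (λ asc (m<ys , u , gap) →
        ascending-∷ z<s (All.map (<⇒≤ ∘ <⇒≤) m<ys) asc
      , (≤-refl ∷ All.map (<⇒≤ ∘ <⇒≤) m<ys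
        , All.map (<⇒≢ ∘ <⇒≤) m<ys ∷ u , linked-∷ m<ys gap)
      , λ { (m<m ∷ _ , _) → n≮n _ m<m })
    where
    linked-∷ : ∀ {ys} → Above (suc (suc m)) ys → Linked (λ x y → x + 2 ≤ y) ys → Linked (λ x y → x + 2 ≤ y) (suc m ∷ ys)
    linked-∷ []         _   = [-]
    linked-∷ (m<y ∷ _) gap = ≤-trans (≤-reflexive (+-comm (suc m) 2)) m<y ∷ gap
    split : ∀ {xs} → Ascending xs → Above m xs × GapCondition xs → _
    split asc (m<xs , u , gap) with least asc m<xs
    ... | inj₁ m+1<xs = inj₁ (m+1<xs , u , gap)
    ... | inj₂ (ys , refl , ascʸ , _) with u
         | Linked⇒AllPairs (λ {x} x+2≤y y+2≤z → ≤-trans (≤-trans x+2≤y (m≤m+n _ 2)) y+2≤z) gap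
    ...   | _ ∷ uʸ | m+3≤ ∷ gapʸ = inj₂ (ys , ascʸ
            , (All.map (≤-trans (≤-reflexive (+-comm 2 (suc m)))) m+3≤ , uʸ , AllPairs⇒Linked gapʸ) , refl)

  -- Parts may repeat, so after removal of one part m + 1 the bound on the others stays at m.
  mod5-step : ∀ m → suc m % 5 ≡ 1 ⊎ suc m % 5 ≡ 4 → ∀ n → count (mod5Above? m) n ≡
              count (mod5Above? (suc m)) n + shift 0 (suc m) (count (mod5Above? m)) n
  mod5-step m m∈ = count-split (mod5Above? m) (mod5Above? (suc m)) (mod5Above? m) (suc m) (suc m ∷_)
    ∷-injectiveʳ (λ _ → refl) split
    (λ _ (m<xs , mod5) → All.map <⇒≤ m<xs , mod5)
    (λ asc (m<ys , mod5) → ascending-∷ z<s m<ys asc , (≤-refl ∷ m<ys , m∈ ∷ mod5) , λ { (m<m ∷ _ , _) → n≮n _ m<m })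
    where
    split : ∀ {xs} → Ascending xs → Above m xs × Mod5Condition xs → _
    split asc (m<xs , mod5) with least asc m<xs
    ... | inj₁ m+1<xs = inj₁ (m+1<xs , mod5)
    ... | inj₂ (ys , refl , ascʸ , m<ys) = inj₂ (ys , ascʸ , (m<ys , All.tail mod5) , refl)

  mod5-skip : ∀ m → ¬ (suc m % 5 ≡ 1 ⊎ suc m % 5 ≡ 4) → ∀ n → count (mod5Above? m) n ≡ count (mod5Above? (suc m)) n
  mod5-skip m m∉ = count-cong (mod5Above? m) (mod5Above? (suc m)) to (λ _ (m<xs , mod5) → All.map <⇒≤ m<xs , mod5)
    where
    to : ∀ {xs} → Ascending xs → Above m xs × Mod5Condition xs → Above (suc m) xs × Mod5Condition xs
    to asc (m<xs , mod5) with least asc m<xs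
    ... | inj₁ m+1<xs = m+1<xs , mod5
    ... | inj₂ (_ , refl , _) = contradiction (All.head mod5) m∉

  -- Dominoes and monomers: the recurrences for C and D

  -- The condition Avoids when j further, smaller entries of ps have been removed;
  -- AvoidsFrom 0 is Avoids.
  AvoidsFrom : (j : ℕ) (ps xs : List ℕ) → Set
  AvoidsFrom j ps xs = (i : Fin (length ps)) →
    (lookup ps i + 2 * (j + suc (toℕ i)) ∸ 3) ∉ xs × (lookup ps i + 2 * (j + suc (toℕ i)) ∸ 1) ∉ xs

  avoidsFrom? : ∀ j ps → Decidable (AvoidsFrom j ps)
  avoidsFrom? j ps xs = all? λ _ → ¬? (_ ∈? xs) ×-dec ¬? (_ ∈? xs)

  avoids-∷ : ∀ j p ps {xs} → (p + 2 * (j + 1) ∸ 3) ∉ xs → (p + 2 * (j + 1) ∸ 1) ∉ xs →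
             AvoidsFrom (suc j) ps xs → AvoidsFrom j (p ∷ ps) xs
  avoids-∷ j p ps a b rest zero = a , b
  avoids-∷ j p ps a b rest (suc i) rewrite +-suc j (suc (toℕ i)) = rest i

  avoids-tail : ∀ j p ps {xs} → AvoidsFrom j (p ∷ ps) xs → AvoidsFrom (suc j) ps xs
  avoids-tail j p ps {xs} av i = subst (λ k → (lookup ps i + 2 * k ∸ 3) ∉ xs × (lookup ps i + 2 * k ∸ 1) ∉ xs)
    (+-suc j (suc (toℕ i))) (av (suc i))

  avoids-⊆ : ∀ j ps {xs ys} → (∀ {x} → x ∈ ys → x ∈ xs) → AvoidsFrom j ps xs → AvoidsFrom j ps ys
  avoids-⊆ j ps ys⊆xs av i = proj₁ (av i) ∘ ys⊆xs , proj₂ (av i) ∘ ys⊆xs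

  -- Every entry p has index at least j + 1, so both numbers that it forbids are at least p + 2(j +
  -- 1) - 3, which exceeds c.
  avoids-extend : ∀ j {c} ps {xs} → All (λ p → c + 3 < p + 2 * suc j) ps →
                  AvoidsFrom j ps xs → AvoidsFrom j ps (c ∷ xs)
  avoids-extend j {c} ps far av i =
      (λ { (here eq) → <⇒≢ c<t∸3 (sym eq) ; (there ∈xs) → proj₁ (av i) ∈xs })
    , (λ { (here eq) → <⇒≢ (<-≤-trans c<t∸3 (∸-monoʳ-≤ {1} {3} t (s≤s z≤n))) (sym eq) ; (there ∈xs) → proj₂ (av i) ∈xs })
    where
    t = lookup ps i + 2 * (j + suc (toℕ i))
    c+3<t : c + 3 < t
    c+3<t = <-≤-trans (All.lookup far (∈-lookup i))
      (+-monoʳ-≤ (lookup ps i) (*-monoʳ-≤ 2 (≤-trans (s≤s (m≤m+n j (toℕ i))) (≤-reflexive (sym (+-suc j (toℕ i)))))))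
    c<t∸3 : c < t ∸ 3
    c<t∸3 = m+n≤o⇒m≤o∸n (suc c) c+3<t

  -- When j smaller dominoes have been removed, the domino of a part a + 1 covers the neighbouring
  -- monomer places a + 2j and a + 2j + 2.
  first-forbidden : ∀ a j → suc a + 2 * (j + 1) ∸ 3 ≡ a + 2 * j
  first-forbidden a j = cong (_∸ 3) (lemma a j)
    where
    lemma : ∀ a j → suc a + 2 * (j + 1) ≡ 3 + (a + 2 * j)
    lemma = solve-∀

  second-forbidden : ∀ a j → suc a + 2 * (j + 1) ∸ 1 ≡ 2 + (a + 2 * j)
  second-forbidden a j = lemma a j
    where
    lemma : ∀ a j → a + 2 * (j + 1) ≡ 2 + (a + 2 * j)
    lemma = solve-∀

  ∉-∷ : ∀ {x y : ℕ} {ys} → x ≢ y → x ∉ ys → x ∉ y ∷ ys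
  ∉-∷ x≢y x∉ (here x≡y)  = x≢y x≡y
  ∉-∷ x≢y x∉ (there x∈) = x∉ x∈

  module Parity {D : Pred ℕ 0ℓ} (D? : Decidable D)
    (alternate⁺ : ∀ {x} → ¬ D x → D (suc x)) (alternate⁻ : ∀ {x} → D x → ¬ D (suc x)) where

    -- The parts satisfying D play the role of dominoes, the others of monomers.
    Configuration : (j a b : ℕ) → Pred (List ℕ) 0ℓ
    Configuration j a b xs = Unique xs × All (λ x → D x → a ≤ x) xs × All (λ x → ¬ D x → b ≤ x) xs
      × AvoidsFrom j (filter D? xs) xs

    configuration? : ∀ j a b → Decidable (Configuration j a b)
    configuration? j a b xs = unique? xs ×-dec All.all? (λ x → D? x →-dec (a ≤? x)) xs
      ×-dec All.all? (λ x → ¬? (D? x) →-dec (b ≤? x)) xs ×-dec avoidsFrom? j (filter D? xs) xs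

    ¬D-+2* : ∀ {x} j → ¬ D x → ¬ D (x + 2 * j)
    ¬D-+2* {x} zero    ¬Dx = subst (¬_ ∘ D) (sym (+-identityʳ x)) ¬Dx
    ¬D-+2* {x} (suc j) ¬Dx = subst (¬_ ∘ D) (lemma x j) (alternate⁻ (alternate⁺ (¬D-+2* j ¬Dx)))
      where
      lemma : ∀ x j → 2 + (x + 2 * j) ≡ x + 2 * suc j
      lemma = solve-∀

    raise-D : ∀ {a x} → D a → a ≢ x → (D x → a ≤ x) → D x → 2 + a ≤ x
    raise-D Da a≢x a≤ Dx = ≤∧≢⇒< (≤∧≢⇒< (a≤ Dx) a≢x) λ { refl → alternate⁻ Da Dx }

    raise-¬D : ∀ {b x} → ¬ D b → b ≢ x → (¬ D x → b ≤ x) → ¬ D x → 2 + b ≤ x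
    raise-¬D ¬Db b≢x b≤ ¬Dx = ≤∧≢⇒< (≤∧≢⇒< (b≤ ¬Dx) b≢x) λ { refl → ¬Dx (alternate⁺ ¬Db) }

    lower : ∀ {a} {S : Pred ℕ 0ℓ} {xs} → All (λ x → S x → 2 + a ≤ x) xs → All (λ x → S x → a ≤ x) xs
    lower = All.map (λ h s → ≤-trans (m≤n+m _ 2) (h s))

    -- A part a + 1 is the least part here, as monomers start at f + 2. Its domino covers f, which
    -- holds no monomer, and f + 2, so the remaining monomers start at f + 4. Without it, parity
    -- raises the bound on dominoes to a + 3.
    domino-step : ∀ j a → D (suc a) → ∀ n → count (configuration? j (suc a) (2 + (a + 2 * j))) n ≡
      count (configuration? j (3 + a) (2 + (a + 2 * j))) n
        + shift 0 (suc a) (count (configuration? (suc j) (3 + a) (4 + (a + 2 * j)))) n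
    domino-step j a Da = count-split (configuration? j (suc a) (2 + f)) (configuration? j (3 + a) (2 + f)) (configuration? (suc j) (3 + a) (4 + f))
      (suc a) (suc a ∷_) ∷-injectiveʳ (λ _ → refl) split
      (λ _ (u , D≥ , ¬D≥ , av) → u , lower D≥ , ¬D≥ , av)
      fromR
      where
      f = a + 2 * j
      ¬Df : ¬ D f
      ¬Df = ¬D-+2* j (λ Da' → alternate⁻ Da' Da)
      ¬D2+f : ¬ D (2 + f)
      ¬D2+f = alternate⁻ (alternate⁺ ¬Df)
      a<2+f : suc a ≤ 2 + f
      a<2+f = s≤s (≤-trans (m≤m+n a (2 * j)) (n≤1+n f))
      split : ∀ {xs} → Ascending xs → Configuration j (suc a) (2 + f) xs → _
      split {xs} asc (u , D≥ , ¬D≥ , av) with suc a ∈? xs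
      ... | no a∉ = inj₁ (u , All.tabulate (λ x∈ → raise-D Da (λ { refl → a∉ x∈ }) (All.lookup D≥ x∈)) , ¬D≥ , av)
      ... | yes a∈ with uninsert asc a∈
      ...   | ys , ascʸ , refl = inj₂ (ys , ascʸ , (uʸ
                , All.tabulate (λ x∈ → raise-D Da (All.lookup a≢ x∈) (All.lookup D≥ (there' x∈)))
                , All.tabulate (λ x∈ → raise-¬D ¬D2+f (λ { refl → 2+f∉ (there x∈) }) (All.lookup ¬D≥ (there' x∈)))
                , avoids-⊆ (suc j) (filter D? ys) there (avoids-tail j (suc a) (filter D? ys) av')) , eq)
        where
        perm = insert-↭ (suc a) ys
        there' : ∀ {x} → x ∈ ys → x ∈ insert (suc a) ys
        there' = ∈-resp-↭ (↭-sym perm) ∘ there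
        ≥a : ∀ {x} → x ∈ ys → suc a ≤ x
        ≥a {x} x∈ with D? x
        ... | yes Dx = All.lookup D≥ (there' x∈) Dx
        ... | no ¬Dx = ≤-trans a<2+f (All.lookup ¬D≥ (there' x∈) ¬Dx)
        eq : insert (suc a) ys ≡ suc a ∷ ys
        eq = insert-≤ (All.tabulate ≥a)
        u' = unique-resp-↭ perm u
        a≢ = AllPairs.head u'
        uʸ = AllPairs.tail u'
        av' : AvoidsFrom j (suc a ∷ filter D? ys) (suc a ∷ ys)
        av' = subst (λ ps → AvoidsFrom j ps (suc a ∷ ys)) (filter-accept D? Da)
          (subst (λ xs → AvoidsFrom j (filter D? xs) xs) eq av)
        2+f∉ : 2 + f ∉ suc a ∷ ys
        2+f∉ = subst (_∉ suc a ∷ ys) (second-forbidden a j) (proj₂ (av' zero))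
      fromR : ∀ {ys} → Ascending ys → Configuration (suc j) (3 + a) (4 + f) ys → _
      fromR {ys} asc (u , D≥ , ¬D≥ , av) =
          ascending-∷ z<s (All.map <⇒≤ >a) asc
        , ( All.map <⇒≢ >a ∷ u , (λ _ → ≤-refl) ∷ lower D≥ , (λ ¬Da → contradiction Da ¬Da) ∷ lower ¬D≥
          , subst (λ ps → AvoidsFrom j ps (suc a ∷ ys)) (sym (filter-accept D? Da))
              (avoids-∷ j (suc a) (filter D? ys)
                (subst (_∉ suc a ∷ ys) (sym (first-forbidden a j))
                  (∉-∷ (λ f≡ → ¬Df (subst D (sym f≡) Da)) (∉ys ¬Df (s≤s (m≤n+m f 3)))))
                (subst (_∉ suc a ∷ ys) (sym (second-forbidden a j))
                  (∉-∷ (λ f≡ → ¬D2+f (subst D (sym f≡) Da)) (∉ys ¬D2+f (n≤1+n (3 + f)))))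
                (avoids-extend (suc j) (filter D? ys) (All.tabulate far) av)))
        , λ { (_ , 3+a≤ ∷ _ , _) → contradiction (3+a≤ Da) (<⇒≱ (n≤1+n (2 + a))) }
        where
        >a : All (suc a <_) ys
        >a = All.tabulate >a'
          where
          >a' : ∀ {y} → y ∈ ys → suc a < y
          >a' {y} y∈ with D? y
          ... | yes Dy = ≤-trans (n≤1+n (2 + a)) (All.lookup D≥ y∈ Dy)
          ... | no ¬Dy = ≤-trans (s≤s (s≤s (≤-trans (m≤m+n a (2 * j)) (m≤n+m f 2)))) (All.lookup ¬D≥ y∈ ¬Dy)
        ∉ys : ∀ {x} → ¬ D x → x < 4 + f → x ∉ ys
        ∉ys ¬Dx x< x∈ = <⇒≱ x< (All.lookup ¬D≥ x∈ ¬Dx)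
        far : ∀ {p} → p ∈ filter D? ys → suc a + 3 < p + 2 * suc (suc j)
        far {p} p∈ with ∈-filter⁻ D? {xs = ys} p∈
        ... | p∈ys , Dp = ≤-trans (≤-reflexive (lemma a)) (+-mono-≤ (All.lookup D≥ p∈ys Dp) (*-monoʳ-≤ 2 {1} (s≤s (z≤n {suc j}))))
          where
          lemma : ∀ a → suc (suc a + 3) ≡ 3 + a + 2 * 1
          lemma = solve-∀

    -- A part a + 1 would be the first domino and would forbid f, so the monomer f excludes it.
    -- Removing f thus raises both bounds by 2 and keeps j. Positivity of f is needed for it to be a
    -- part.
    monomer-step : ∀ j a → D (suc a) → 0 < a + 2 * j → ∀ n → count (configuration? j (suc a) (a + 2 * j)) n ≡
      count (configuration? j (suc a) (2 + (a + 2 * j))) n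
        + shift 0 (a + 2 * j) (count (configuration? j (3 + a) (2 + (a + 2 * j)))) n
    monomer-step j a Da 0<f = count-split (configuration? j (suc a) f) (configuration? j (suc a) (2 + f)) (configuration? j (3 + a) (2 + f))
      f (insert f) (insert-injective f) (sum-insert f) split
      (λ _ (u , D≥ , ¬D≥ , av) → u , D≥ , lower ¬D≥ , av)
      fromR
      where
      f = a + 2 * j
      ¬Df : ¬ D f
      ¬Df = ¬D-+2* j (λ Da' → alternate⁻ Da' Da)
      split : ∀ {xs} → Ascending xs → Configuration j (suc a) f xs → _
      split {xs} asc (u , D≥ , ¬D≥ , av) with f ∈? xs
      ... | no f∉ = inj₁ (u , D≥ , All.tabulate (λ x∈ → raise-¬D ¬Df (λ { refl → f∉ x∈ }) (All.lookup ¬D≥ x∈)) , av)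
      ... | yes f∈ with uninsert asc f∈
      ...   | ys , ascʸ , refl = inj₂ (ys , ascʸ , (AllPairs.tail u'
                , All.tabulate (λ x∈ → raise-D Da (λ { refl → a∉ x∈ }) (All.lookup D≥ (there' x∈)))
                , All.tabulate (λ x∈ → raise-¬D ¬Df (All.lookup (AllPairs.head u') x∈) (All.lookup ¬D≥ (there' x∈)))
                , avoids-⊆ j (filter D? ys) there' av') , refl)
        where
        perm = insert-↭ f ys
        there' : ∀ {x} → x ∈ ys → x ∈ insert f ys
        there' = ∈-resp-↭ (↭-sym perm) ∘ there
        u' = unique-resp-↭ perm u
        av' : AvoidsFrom j (filter D? ys) (insert f ys)
        av' = subst (λ ps → AvoidsFrom j ps (insert f ys)) (filter-insert D? ¬Df ys) av
        a∉ : suc a ∉ ys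
        a∉ a∈ with uninsert ascʸ a∈
        ... | zs , _ , refl = subst (_∉ insert f ys) (first-forbidden a j)
            (proj₁ (subst (λ ps → AvoidsFrom j ps (insert f ys)) eq av' zero)) f∈
          where
          eq : filter D? (insert (suc a) zs) ≡ suc a ∷ filter D? zs
          eq = filter-insert-head D? Da (All.tabulate λ x∈ → All.lookup D≥ (there' (∈-resp-↭ (↭-sym (insert-↭ (suc a) zs)) (there x∈))))
      fromR : ∀ {ys} → Ascending ys → Configuration j (3 + a) (2 + f) ys → _
      fromR {ys} asc (u , D≥ , ¬D≥ , av) =
          insert-ascending 0<f asc
        , ( unique-resp-↭ (↭-sym perm) (All.tabulate (λ { x∈ refl → f∉ x∈ }) ∷ u)
          , All-resp-↭ (↭-sym perm) ((λ Df → contradiction Df ¬Df) ∷ lower D≥)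
          , All-resp-↭ (↭-sym perm) ((λ _ → ≤-refl) ∷ lower ¬D≥)
          , subst (λ ps → AvoidsFrom j ps (insert f ys)) (sym (filter-insert D? ¬Df ys))
              (avoids-⊆ j (filter D? ys) (∈-resp-↭ perm) (avoids-extend j (filter D? ys) (All.tabulate far) av)))
        , λ { (_ , _ , 2+f≤ , _) → contradiction (All.lookup 2+f≤ (∈-resp-↭ (↭-sym perm) (here refl)) ¬Df) (<⇒≱ (n≤1+n (suc f))) }
        where
        perm = insert-↭ f ys
        f∉ : f ∉ ys
        f∉ f∈ = <⇒≱ (n≤1+n (suc f)) (All.lookup ¬D≥ f∈ ¬Df)
        far : ∀ {p} → p ∈ filter D? ys → f + 3 < p + 2 * suc j
        far {p} p∈ with ∈-filter⁻ D? {xs = ys} p∈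
        ... | p∈ys , Dp = ≤-trans (≤-trans (n≤1+n _) (≤-reflexive (lemma a j))) (+-monoˡ-≤ (2 * suc j) (All.lookup D≥ p∈ys Dp))
          where
          lemma : ∀ a j → 2 + (a + 2 * j + 3) ≡ 3 + a + 2 * suc j
          lemma = solve-∀

open Counting
open import Data.Nat.Tactic.RingSolver using (solve-∀)

-- Solving the domino and monomer recurrences

module DominoRecurrences {c ℓ} (R : CommutativeRing c ℓ) (q : CommutativeRing.Carrier R) (N : ℕ) where
  open CommutativeRing R
  open import Algebra.Properties.Semiring.Exp semiring
  open import Relation.Binary.Reasoning.Setoid setoid
  open IntegerCoefficients R

  module _
    (S : Pred ℕ 0ℓ) (S-+2 : ∀ {a} → S a → S (2 ℕ.+ a)) (V W : ℕ → ℕ → Carrier)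
    (domino : ∀ j a → S a → V j a ≈ W j (2 ℕ.+ a) + q ^ suc a * W (suc j) (2 ℕ.+ a))
    (monomer : ∀ j a → S a → 0 < a ℕ.+ 2 ℕ.* j → W j a ≈ V j a + q ^ (a ℕ.+ 2 ℕ.* j) * W j (2 ℕ.+ a))
    (V-limit : ∀ j a → N ≤ a → V j a ≈ 1#)
    (W-limit : ∀ j m a → N ≤ m → m < a ℕ.+ 2 ℕ.* j → m ≤ a → W j a ≈ 1#)
    where

    0<a+2* : ∀ a j → 0 < a ℕ.+ 2 ℕ.* suc j
    0<a+2* a j = ℕ.≤-trans (s≤s z≤n) (ℕ.m≤n+m (2 ℕ.* suc j) a)

    -- Unfold one domino step and then a monomer step in each term, and exchange their order. The
    -- induction hypothesis at a + 2, for j and j + 1, raises every index by one, and the two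
    -- recurrences fold back up. Here `S a` will say that a + 1 has the parity of the dominoes.
    V≈W : ∀ a → S a → ∀ j → V j a ≈ W (suc j) a
    V≈W = descend N
      (λ a N≤a _ j → trans (V-limit j a N≤a) (sym (W-limit (suc j) a a N≤a
        (ℕ.m<m+n a (s≤s z≤n)) ℕ.≤-refl)))
      (λ a _ ih Sa j →
        let x  = q ^ suc a
            b  = q ^ (a ℕ.+ 2 ℕ.* suc j)
            Sa' = S-+2 Sa
        in begin
        V j a
          ≈⟨ domino j a Sa ⟩
        W j (2 ℕ.+ a) + x * W (suc j) (2 ℕ.+ a)
          ≈⟨ +-cong (trans (monomer j (2 ℕ.+ a) Sa' (s≤s z≤n)) (+-congˡ (*-congʳ (^-congʳ q (shift-index a j)))))
               (*-congˡ (monomer (suc j) (2 ℕ.+ a) Sa' (s≤s z≤n))) ⟩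
        (V j (2 ℕ.+ a) + b * W j (4 ℕ.+ a)) + x * (V (suc j) (2 ℕ.+ a) + q * (q * b) * W (suc j) (4 ℕ.+ a))
          -- A monomer removed after a domino weighs q²b instead of b, because the domino has pushed
          -- it up by one place. Giving this q² to x yields q^(a+3), the weight of the domino
          -- removed after the monomer.
          ≈⟨ solve 7 (λ q x b v v' w w' → (v :+ b :* w) :+ x :* (v' :+ q :* (q :* b) :* w') :=
               (v :+ x :* v') :+ b :* (w :+ q :* (q :* x) :* w')) refl
               q x b (V j (2 ℕ.+ a)) (V (suc j) (2 ℕ.+ a)) (W j (4 ℕ.+ a)) (W (suc j) (4 ℕ.+ a)) ⟩
        (V j (2 ℕ.+ a) + x * V (suc j) (2 ℕ.+ a)) + b * (W j (4 ℕ.+ a) + q ^ (3 ℕ.+ a) * W (suc j) (4 ℕ.+ a))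
          ≈⟨ +-cong (+-cong (ih Sa' j) (*-congˡ (ih Sa' (suc j))))
               (*-congˡ (trans (sym (domino j (2 ℕ.+ a) Sa')) (ih Sa' j))) ⟩
        (W (suc j) (2 ℕ.+ a) + x * W (suc (suc j)) (2 ℕ.+ a)) + b * W (suc j) (2 ℕ.+ a)
          ≈⟨ +-congʳ (domino (suc j) a Sa) ⟨
        V (suc j) a + b * W (suc j) (2 ℕ.+ a)
          ≈⟨ monomer (suc j) a Sa (0<a+2* a j) ⟨
        W (suc j) a ∎)
      where
      shift-index : ∀ a j → 2 ℕ.+ a ℕ.+ 2 ℕ.* j ≡ a ℕ.+ 2 ℕ.* suc j
      shift-index = solve-∀

    module _ (A : ℕ → Carrier) (A-rec : ∀ m → A m ≈ A (suc m) + q ^ suc m * A (suc (suc m)))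
             (A-limit : ∀ m → N ≤ m → A m ≈ 1#) where

      -- The two claims alternate with the parity of m and feed each other. The only term that
      -- leaves j = 0 is `W 1 (2 + m)`, and `V≈W` turns it back into `V 0 (2 + m)`.
      V≈A×W≈A : ∀ m → (S m → V 0 m ≈ A m) × (S (suc m) → W 0 (suc m) ≈ A m)
      V≈A×W≈A = descend N
        (λ m N≤m → (λ _ → trans (V-limit 0 m N≤m) (sym (A-limit m N≤m)))
                 , (λ _ → trans (W-limit 0 m (suc m) N≤m (ℕ.m≤m+n (suc m) 0) (ℕ.n≤1+n m)) (sym (A-limit m N≤m))))
        (λ m (V₁ , W₁) (V₂ , W₂) →
            (λ Sm → begin
              V 0 m
                ≈⟨ domino 0 m Sm ⟩
              W 0 (2 ℕ.+ m) + q ^ suc m * W 1 (2 ℕ.+ m)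
                ≈⟨ +-cong (W₁ (S-+2 Sm)) (*-congˡ (trans (sym (V≈W (2 ℕ.+ m) (S-+2 Sm) 0)) (V₂ (S-+2 Sm)))) ⟩
              A (suc m) + q ^ suc m * A (2 ℕ.+ m)
                ≈⟨ A-rec m ⟨
              A m ∎)
          , (λ Sm → begin
              W 0 (suc m)
                ≈⟨ monomer 0 (suc m) Sm (s≤s z≤n) ⟩
              V 0 (suc m) + q ^ (suc m ℕ.+ 0) * W 0 (3 ℕ.+ m)
                ≈⟨ +-cong (V₁ Sm) (*-cong (^-congʳ q (ℕ.+-identityʳ (suc m))) (W₂ (S-+2 Sm))) ⟩
              A (suc m) + q ^ suc m * A (2 ℕ.+ m)
                ≈⟨ A-rec m ⟨
              A m ∎))

-- Generating functions of the counts modulo q^N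

module Generating (M : ℕ) where
  N = suc M
  R = Truncated.commutativeRing N
  open CommutativeRing R
  open import Algebra.Properties.Semiring.Exp semiring
  open IntegerCoefficients R
  open QSeries R using (eliminate)
  open import Relation.Binary.Reasoning.Setoid setoid
  open import Data.List.Relation.Unary.AllPairs using ([])
  open import Data.List.Relation.Unary.Linked using ([])

  infix 8 ⟨_⟩
  ⟨_⟩ : (ℕ → ℕ) → Series
  ⟨ f ⟩ n = + f n

  shift-⟨⟩ : ∀ f c → shift (+ 0) c ⟨ f ⟩ ≗ ⟨ shift 0 c f ⟩
  shift-⟨⟩ f zero    n       = ≡.refl
  shift-⟨⟩ f (suc c) zero    = ≡.refl
  shift-⟨⟩ f (suc c) (suc n) = shift-⟨⟩ f c n

  ⟨⟩-rec : ∀ {f g h} c → (∀ n → f n ≡ g n ℕ.+ shift 0 c h n) → ⟨ f ⟩ ≈ ⟨ g ⟩ + q ^ c * ⟨ h ⟩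
  ⟨⟩-rec {f} {g} {h} c rec k _ = ≡.trans (≡.cong +_ (rec k)) (≡.trans (ℤ.pos-+ (g k) (shift 0 c h k))
    (≡.cong (ℤ._+_ (+ g k)) (≡.sym (≡.trans (q^-⊛ N c ⟨ h ⟩ k) (shift-⟨⟩ h c k)))))

  ⟨⟩-limit : {P : Pred (List ℕ) 0ℓ} (P? : Decidable P) → P [] → ∀ m → N ≤ m →
             (∀ {xs} → Ascending xs → P xs → Above m xs) → ⟨ count P? ⟩ ≈ 1#
  ⟨⟩-limit P? p[] m N≤m above zero    _   = ≡.cong +_ (count-zero P? p[])
  ⟨⟩-limit P? p[] m N≤m above (suc k) k<N = ≡.cong +_ (count-small P? m above k (ℕ.<⇒≤ (ℕ.<-≤-trans k<N N≤m)))

  gaps mod5s : ℕ → Series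
  gaps m  = ⟨ count (gapAbove? m) ⟩
  mod5s m = ⟨ count (mod5Above? m) ⟩

  gaps-rec : ∀ m → gaps m ≈ gaps (suc m) + q ^ suc m * gaps (suc (suc m))
  gaps-rec m = ⟨⟩-rec (suc m) (gap-step m)

  gaps-limit : ∀ m → N ≤ m → gaps m ≈ 1#
  gaps-limit m N≤m = ⟨⟩-limit (gapAbove? m) ([] , [] , []) m N≤m (λ _ → proj₁)

  mod5s-limit : ∀ m → N ≤ m → mod5s m ≈ 1#
  mod5s-limit m N≤m = ⟨⟩-limit (mod5Above? m) ([] , []) m N≤m (λ _ → proj₁)

  mod5s-factor : ∀ m → suc m % 5 ≡ 1 ⊎ suc m % 5 ≡ 4 → (1# - q ^ suc m) * mod5s m ≈ mod5s (suc m)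
  mod5s-factor m m∈ = eliminate 1# (⟨⟩-rec (suc m) (mod5-step m m∈))
    (solve 3 (λ x b b' → (𝟙 :- x) :* b := b' :+ 𝟙 :* (b :- (b' :+ x :* b))) refl (q ^ suc m) (mod5s m) (mod5s (suc m)))

  mod5s-skip : ∀ m → ¬ (suc m % 5 ≡ 1 ⊎ suc m % 5 ≡ 4) → mod5s m ≈ mod5s (suc m)
  mod5s-skip m m∉ k _ = ≡.cong +_ (mod5-skip m m∉ k)

  mod5s-rec : ∀ i → (1# - q ^ (1 ℕ.+ i ℕ.* 5)) * (1# - q ^ (4 ℕ.+ i ℕ.* 5)) * mod5s (i ℕ.* 5) ≈ mod5s (suc i ℕ.* 5)
  mod5s-rec i = begin
    u₁ * u₄ * mod5s k                 ≈⟨ solve 3 (λ u v b → u :* v :* b := v :* (u :* b)) refl u₁ u₄ (mod5s k) ⟩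
    u₄ * (u₁ * mod5s k)               ≈⟨ *-congˡ (mod5s-factor k (inj₁ (residue 1))) ⟩
    u₄ * mod5s (1 ℕ.+ k)              ≈⟨ *-congˡ (trans
                                           (mod5s-skip (1 ℕ.+ k) (skip 2 (λ ()) (λ ())))
                                           (mod5s-skip (2 ℕ.+ k) (skip 3 (λ ()) (λ ())))) ⟩
    u₄ * mod5s (3 ℕ.+ k)              ≈⟨ mod5s-factor (3 ℕ.+ k) (inj₂ (residue 4)) ⟩
    mod5s (4 ℕ.+ k)                   ≈⟨ mod5s-skip (4 ℕ.+ k) (skip 5 (λ ()) (λ ())) ⟩
    mod5s (5 ℕ.+ k)                   ∎
    where
    k = i ℕ.* 5
    u₁ = 1# - q ^ (1 ℕ.+ k)
    u₄ = 1# - q ^ (4 ℕ.+ k)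
    residue : ∀ j → (j ℕ.+ k) % 5 ≡ j % 5
    residue j = [m+kn]%n≡m%n j i 5
    skip : ∀ j → j % 5 ≢ 1 → j % 5 ≢ 4 → ¬ ((j ℕ.+ k) % 5 ≡ 1 ⊎ (j ℕ.+ k) % 5 ≡ 4)
    skip j ≢1 ≢4 (inj₁ eq) = ≢1 (≡.trans (≡.sym (residue j)) eq)
    skip j ≢1 ≢4 (inj₂ eq) = ≢4 (≡.trans (≡.sym (residue j)) eq)

  gaps≈mod5s : gaps 0 ≈ mod5s 0
  gaps≈mod5s = QSeries.Nilpotent.rogersRamanujan R q M (q^N≈0 N) gaps mod5s gaps-rec gaps-limit mod5s-rec mod5s-limit

  module _ {D : Pred ℕ 0ℓ} (D? : Decidable D)
    (alternate⁺ : ∀ {x} → ¬ D x → D (suc x)) (alternate⁻ : ∀ {x} → D x → ¬ D (suc x)) where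
    open Parity D? alternate⁺ alternate⁻

    -- At position a the least possible domino is the part a + 1 and the first monomer place is a +
    -- 2j; both move up by 2 with a. The bound in `V` skips that place.
    V W : ℕ → ℕ → Series
    V j a = ⟨ count (configuration? j (suc a) (2 ℕ.+ (a ℕ.+ 2 ℕ.* j))) ⟩
    W j a = ⟨ count (configuration? j (suc a) (a ℕ.+ 2 ℕ.* j)) ⟩

    configuration-limit : ∀ j m a b → N ≤ m → m < a → m < b → ⟨ count (configuration? j a b) ⟩ ≈ 1#
    configuration-limit j m a b N≤m m<a m<b = ⟨⟩-limit (configuration? j a b) ([] , [] , [] , λ ()) m N≤m above
      where
      above : ∀ {xs} → Ascending xs → Configuration j a b xs → Above m xs
      above _ (_ , a≤ , b≤ , _) = All.zipWith bound (a≤ , b≤)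
        where
        bound : ∀ {x} → (D x → a ≤ x) × (¬ D x → b ≤ x) → m < x
        bound {x} (a≤x , b≤x) with D? x
        ... | yes Dx = ℕ.<-≤-trans m<a (a≤x Dx)
        ... | no ¬Dx = ℕ.<-≤-trans m<b (b≤x ¬Dx)

    open DominoRecurrences R q N
    V≈gaps×W≈gaps : ∀ m → (D (suc m) → V 0 m ≈ gaps m) × (D (suc (suc m)) → W 0 (suc m) ≈ gaps m)
    V≈gaps×W≈gaps = V≈A×W≈A (D ∘ suc) (alternate⁺ ∘ alternate⁻) V W
      (λ j a Da → ⟨⟩-rec (suc a) λ n → ≡.trans (domino-step j a Da n)
        (≡.cong (λ b → count (configuration? j (3 ℕ.+ a) (2 ℕ.+ (a ℕ.+ 2 ℕ.* j))) n
          ℕ.+ shift 0 (suc a) (count (configuration? (suc j) (3 ℕ.+ a) b)) n) (index a j)))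
      (λ j a Da 0<f → ⟨⟩-rec (a ℕ.+ 2 ℕ.* j) (monomer-step j a Da 0<f))
      (λ j a N≤a → configuration-limit j a _ _ N≤a ℕ.≤-refl (s≤s (ℕ.≤-trans (ℕ.m≤m+n a (2 ℕ.* j)) (ℕ.n≤1+n _))))
      (λ j m a N≤m m<f m≤a → configuration-limit j m _ _ N≤m (s≤s m≤a) m<f)
      gaps gaps-rec gaps-limit
      where
      index : ∀ a j → 4 ℕ.+ (a ℕ.+ 2 ℕ.* j) ≡ 2 ℕ.+ a ℕ.+ 2 ℕ.* suc j
      index = solve-∀

-- Parity and the final comparison

even-suc : ∀ {x} → ¬ 2 ∣ x → 2 ∣ suc x
even-suc {zero}        odd = contradiction (2 ∣0) odd
even-suc {suc zero}    odd = ∣-refl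
even-suc {suc (suc x)} odd = ∣m∣n⇒∣m+n ∣-refl (even-suc (odd ∘ ∣m∣n⇒∣m+n ∣-refl))

odd-suc : ∀ {x} → 2 ∣ x → ¬ 2 ∣ suc x
odd-suc {x} 2∣x 2∣1+x = contradiction (∣m+n∣m⇒∣n (≡.subst (2 ∣_) (ℕ.+-comm 1 x) 2∣1+x) 2∣x) (from-no (2 ∣? 1))

Odd : Pred ℕ 0ℓ
Odd x = ¬ 2 ∣ x

odd? : Decidable Odd
odd? x = ¬? (2 ∣? x)

odd-alternate⁺ : ∀ {x} → ¬ Odd x → Odd (suc x)
odd-alternate⁺ {x} ¬odd with 2 ∣? x
... | yes even = odd-suc even
... | no odd   = contradiction odd ¬odd

odd-alternate⁻ : ∀ {x} → Odd x → ¬ Odd (suc x)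
odd-alternate⁻ odd odd' = odd' (even-suc odd)

theorem6 : (n : ℕ) → 0 < n → A n ≡ B n × B n ≡ C n × C n ≡ D n
theorem6 n _ = ≡.trans A≡gaps gaps≡B , ≡.trans (≡.sym gaps≡B) gaps≡C , ≡.trans (≡.sym gaps≡C) gaps≡D
  where
  -- Truncating at q^(n+1) keeps the coefficient of qⁿ.
  open Generating n
  module O = Parity odd? odd-alternate⁺ odd-alternate⁻
  module E = Parity (2 ∣?_) even-suc odd-suc
  gap = count (gapAbove? 0) n
  A≡gaps : A n ≡ gap
  A≡gaps = count-cong gapCondition? (gapAbove? 0) (λ (pos , _) g → pos , g) (λ _ → proj₂) n
  gaps≡B : gap ≡ B n
  gaps≡B = ≡.trans (ℤ.+-injective (gaps≈mod5s n ℕ.≤-refl))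
    (count-cong (mod5Above? 0) mod5Condition? (λ _ → proj₂) (λ (pos , _) g → pos , g) n)
  gaps≡C : gap ≡ C n
  gaps≡C = ≡.trans (≡.sym (ℤ.+-injective (proj₁ (V≈gaps×W≈gaps odd? odd-alternate⁺ odd-alternate⁻ 0)
      (from-no (2 ∣? 1)) n ℕ.≤-refl)))
    -- For odd dominoes `V 0 0` applies: its bounds, 1 for odd and 2 for even parts, hold in every
    -- partition.
    (count-cong (O.configuration? 0 1 2) oddCondition?
      (λ _ (u , _ , _ , av) → u , av)
      (λ (pos , _) (u , av) → u , All.map (λ 0<x _ → 0<x) pos , All.map (λ 0<x → even≥2 0<x) pos , av) n)
    where
    even≥2 : ∀ {x} → 0 < x → ¬ Odd x → 2 ≤ x
    even≥2 {suc zero}    _ ¬odd = contradiction (from-no (2 ∣? 1)) ¬odd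
    even≥2 {suc (suc x)} _ _    = s≤s (s≤s z≤n)
  gaps≡D : gap ≡ D n
  gaps≡D = ≡.trans (≡.sym (ℤ.+-injective (proj₂ (V≈gaps×W≈gaps (2 ∣?_) even-suc odd-suc 0) ∣-refl n ℕ.≤-refl)))
    -- For even dominoes the same m = 0 selects `W 0 1`, whose bounds 2 and 1 are likewise
    -- automatic.
    (count-cong (E.configuration? 0 2 1) evenCondition?
      (λ _ (u , _ , _ , av) → u , av)
      (λ (pos , _) (u , av) → u , All.map (λ 0<x 2∣x → ∣⇒≤ ⦃ ℕ.>-nonZero 0<x ⦄ 2∣x) pos
                              , All.map (λ 0<x _ → 0<x) pos , av) n)
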